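{- Let $\Omega$ be a finite set, let $k,l \geq 2$ be multiplicatively independent integers, and let $f \colon \mathbb{N}_0 \to \Omega$ be a sequence. Suppose that $f$ is asymptotically $k$-automatic and asymptotically $l$-automatic. Then $f$ is asymptotically invariant under a non-zero shift, i.e. there exists $q \in \mathbb{N}$ such that $f(n+q) = f(n)$ for almost all $n \in \mathbb{N}_0$.
   Context: $\mathbb{N} = \{1,2,\dots\}$, $\mathbb{N}_0 = \mathbb{N}\cup\{0\}$. Integers $k,l\geq 2$ are multiplicatively dependent if $\log k/\log l \in \mathbb{Q}$, and multiplicatively independent otherwise. For $A \subset \mathbb{N}_0$, the upper density is $\bar d(A) = \limsup_{N\to\infty} |A\cap\{0,\dots,N-1\}|/N$; a property holds for almost all $n\in\mathbb{N}_0$ if the set of $n$ where it fails has upper density $0$. Two sequences $f,g\colon \mathbb{N}_0\to\Omega$ are asymptotically equal, written $f\simeq g$, if $f(n)=g(n)$ for almost all $n$. The $k$-kernel of $f$ is $\mathcal{N}_k(f) = \{ n \mapsto f(k^\alpha n + r) : \alpha, r \in \mathbb{N}_0,\ r < k^\alpha\}$. The sequence $f$ (with $\Omega$ finite) is asymptotically $k$-automatic if the set of equivalence classes $\mathcal{N}_k(f)/{\simeq}$ is finite. -}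

module Defs where

open import Level using (Level)
open import Data.Fin.Base using (Fin)
open import Data.Fin.Properties using (inj⇒≟)
open import Data.Integer.Base using (+_)
open import Data.List.Base using (length; filter; upTo)
open import Data.Nat.Base using (ℕ; suc; _+_; _*_; _^_; _≤_; _<_)
open import Data.Product.Base using (∃; ∃₂; Σ-syntax; _×_; _,_)
open import Data.Rational.Unnormalised.Base as ℚᵘ using (ℚᵘ; 0ℚᵘ)
open import Function.Base using (_∘_)
open import Function.Bundles using (_↔_)
open import Function.Properties.Inverse using (Inverse⇒Injection)
open import Relation.Binary.Core using (Rel)
open import Relation.Binary.Definitions using (DecidableEquality)
open import Relation.Binary.PropositionalEquality.Core using (_≡_)
open import Relation.Nullary.Decidable.Core using (¬?)
open import Relation.Nullary.Negation.Core using (¬_)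
open import Relation.Unary using (Pred; Decidable; _∈_)

private
  variable
    a p ℓ : Level

Finite : Set a → Set a
Finite Ω = ∃ λ m → Ω ↔ Fin m

finite⇒≟ : {Ω : Set a} → Finite Ω → DecidableEquality Ω
finite⇒≟ (_ , Ω↔Fin) = inj⇒≟ (Inverse⇒Injection Ω↔Fin)

-- log k / log l = a / b, exponentiated.  For k, l ≥ 2 the quotient is
-- positive, so only positive a and b need to be considered.
MultiplicativelyDependent : ℕ → ℕ → Set
MultiplicativelyDependent k l =
  ∃₂ λ a b → 1 ≤ a × 1 ≤ b × k ^ b ≡ l ^ a

MultiplicativelyIndependent : ℕ → ℕ → Set
MultiplicativelyIndependent k l = ¬ MultiplicativelyDependent k l

-- limsup x = L, for a rational value L.
IsLimsup : (ℕ → ℚᵘ) → ℚᵘ → Set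
IsLimsup x L =
  ∀ ε → 0ℚᵘ ℚᵘ.< ε →
    (∃ λ n₀ → ∀ n → n₀ ≤ n → x n ℚᵘ.< L ℚᵘ.+ ε) ×
    (∀ n₀ → ∃ λ n → n₀ ≤ n × L ℚᵘ.- ε ℚᵘ.< x n)

count : {A : Pred ℕ p} → Decidable A → ℕ → ℕ
count A? N = length (filter A? (upTo N))

-- The frequencies |A ∩ {0,…,N-1}| / N are taken along N = suc n to avoid N = 0.
HasUpperDensity : {A : Pred ℕ p} → Decidable A → ℚᵘ → Set
HasUpperDensity A? d = IsLimsup (λ n → + count A? (suc n) ℚᵘ./ suc n) d

AlmostAll : {P : Pred ℕ p} → Decidable P → Set
AlmostAll P? = HasUpperDensity (¬? ∘ P?) 0ℚᵘ

-- The classes of the elements of P modulo _~_ form a finite set: some finite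
-- family of elements of P, possibly with repetitions, meets every class.
FinitelyManyClasses : {X : Set a} → Pred X p → Rel X ℓ → Set _
FinitelyManyClasses {X = X} P _~_ =
  ∃ λ m → Σ[ rep ∈ (Fin m → X) ]
    (∀ i → rep i ∈ P) × (∀ {x} → x ∈ P → ∃ λ i → x ~ rep i)

Kernel : {Ω : Set a} → ℕ → (ℕ → Ω) → Pred (ℕ → Ω) a
Kernel k f g =
  ∃₂ λ α r → r < k ^ α × (∀ n → g n ≡ f (k ^ α * n + r))

module Asymptotic {Ω : Set a} (finite : Finite Ω) where

  infix 4 _≃_

  _≃_ : Rel (ℕ → Ω) _
  f ≃ g = AlmostAll (λ n → finite⇒≟ finite (f n) (g n))

  AsymptoticallyAutomatic : ℕ → (ℕ → Ω) → Set a
  AsymptoticallyAutomatic k f = FinitelyManyClasses (Kernel k f) _≃_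

{-# OPTIONS --safe #-}
module Submission where

-- Up to null sets, f (k^α n + r) depends only on r and on the finite vector T n
-- of values at n of the representatives of the k-kernel; likewise for l with a
-- vector S.  Choose α and β with K = k^α and L = l^β distinct but very close.
-- Among H consecutive windows of length K all but boundedly many have an earlier
-- window, h ≤ H steps before, with the same T and the same S on the nearby
-- windows of length L.  There f is unchanged by the shifts by h K and by h L, so
-- it has the local period h (K − L), hence p = H! |K − L|, which is short compared
-- with K.  This holds outside a set of density η, with p depending on η.
--
-- To obtain one shift for all η, write p = k^v p′ with k ∤ p′.  On good windows
-- the representatives reachable from f in v steps have period p′.  By pigeonhole
-- there are r₀ < r₀ + s ≤ d^d with T (k^α₀ y + r₀) = T (k^α₀ y + r₀ + s) for almost
-- all y, so T has period k^c s on one residue class of windows; since k ∤ p′, a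
-- bounded multiple of p′ leads into that class from any y, and these
-- representatives have period k^c s everywhere.  Finally the set of
-- representatives reachable in v steps contains the one reachable in v′ steps for
-- some v′ ≤ 2^d, and c may be chosen so that k^v′ k^c s does not depend on η.
-- Quantifying over η throughout keeps the argument constructive.

open import Level using (Level)
open import Data.Empty using (⊥-elim)
open import Data.Fin.Base using (Fin; zero; suc; toℕ; fromℕ<; funToFin; finToFun; combine)
import Data.Fin.Properties as Fin
import Data.Integer.Base as ℤ
import Data.Integer.Properties as ℤ
open import Data.List.Base using (length; filter; upTo; []; _∷_; _++_)
open import Data.List.Properties using (upTo-∷ʳ; filter-++; length-++)
open import Data.Nat.Base
open import Data.Nat.Divisibility
open import Data.Nat.DivMod
open import Data.Nat.GCD using (gcd; gcd-greatest; gcd[m,n]∣m; gcd[m,n]∣n; gcd-GCD; gcd[m,n]≢0; c*gcd[m,n]≡gcd[cm,cn]; module Bézout)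
open import Data.Nat.Properties
open import Data.Nat.Tactic.RingSolver using (solve-∀)
open import Data.Product.Base using (∃; ∃₂; _×_; _,_; proj₁; proj₂)
import Data.Rational.Unnormalised.Base as ℚᵘ
import Data.Rational.Unnormalised.Properties as ℚᵘ
open import Data.Sum.Base using (_⊎_; inj₁; inj₂)
open import Function.Base using (_∘_)
open import Function.Bundles using (Injection)
open import Function.Properties.Inverse using (Inverse⇒Injection)
open import Relation.Binary.Definitions using (Tri; tri<; tri≈; tri>)
open import Relation.Binary.PropositionalEquality using (_≡_; refl; sym; trans; cong; cong₂; subst; subst₂; module ≡-Reasoning)
open import Relation.Nullary using (¬_; Dec; yes; no; contradiction)
open import Relation.Nullary.Decidable using (_×-dec_; ¬?; decidable-stable)
open import Relation.Unary using (Pred; Decidable)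
open import Defs

private
  variable
    a p : Level
    Ω : Set a
    P P′ : Pred ℕ p

-- Sums and densities

sum : ℕ → (ℕ → ℕ) → ℕ
sum zero    g = 0
sum (suc N) g = sum N g + g N

sum-cong : ∀ N {g h} → (∀ n → n < N → g n ≡ h n) → sum N g ≡ sum N h
sum-cong zero    eq = refl
sum-cong (suc N) eq = cong₂ _+_ (sum-cong N λ n n<N → eq n (m<n⇒m<1+n n<N)) (eq N ≤-refl)

sum-mono-≤ : ∀ N {g h} → (∀ n → n < N → g n ≤ h n) → sum N g ≤ sum N h
sum-mono-≤ zero    le = z≤n
sum-mono-≤ (suc N) le = +-mono-≤ (sum-mono-≤ N λ n n<N → le n (m<n⇒m<1+n n<N)) (le N ≤-refl)

sum-split : ∀ M N g → sum (M + N) g ≡ sum M g + sum N (λ n → g (M + n))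
sum-split M zero    g = trans (cong (λ x → sum x g) (+-identityʳ M)) (sym (+-identityʳ _))
sum-split M (suc N) g rewrite +-suc M N | sum-split M N g = +-assoc (sum M g) _ _

sum-monoˡ-≤ : ∀ {M N} g → M ≤ N → sum M g ≤ sum N g
sum-monoˡ-≤ {M} g M≤N with o , refl ← m≤n⇒∃[o]m+o≡n M≤N
  rewrite sum-split M o g = m≤m+n _ _

sum-const : ∀ N c → sum N (λ _ → c) ≡ N * c
sum-const zero    c = refl
sum-const (suc N) c = trans (cong (_+ c) (sum-const N c)) (+-comm (N * c) c)

sum-+ : ∀ N g h → sum N (λ n → g n + h n) ≡ sum N g + sum N h
sum-+ zero    g h = refl
sum-+ (suc N) g h rewrite sum-+ N g h = lemma (sum N g) (sum N h) (g N) (h N)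
  where
  lemma : ∀ a b c d → a + b + (c + d) ≡ a + c + (b + d)
  lemma = solve-∀

sum-*ˡ : ∀ c N g → sum N (λ n → c * g n) ≡ c * sum N g
sum-*ˡ c zero    g = sym (*-zeroʳ c)
sum-*ˡ c (suc N) g = trans (cong (_+ c * g N) (sum-*ˡ c N g)) (sym (*-distribˡ-+ c _ _))

term≤sum : ∀ N g {n} → n < N → g n ≤ sum N g
term≤sum (suc N) g {n} n<N with m≤n⇒m<n∨m≡n (≤-pred n<N)
... | inj₁ n<N = ≤-trans (term≤sum N g n<N) (m≤m+n _ _)
... | inj₂ refl = m≤n+m _ _

sum-blocks : ∀ B N g → sum (B * N) g ≡ sum N (λ n → sum B (λ r → g (B * n + r)))
sum-blocks B zero    g = cong (λ x → sum x g) (*-zeroʳ B)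
sum-blocks B (suc N) g
  rewrite *-suc B N | +-comm B (B * N) | sum-split (B * N) B g | sum-blocks B N g = refl

-- Exceptional sets of small density

-- For positive `M`, the mean of `E` over long initial segments is at most 1/M. Natural weights in
-- place of sets turn unions into sums.
Small : ℕ → (ℕ → ℕ) → Set
Small M E = ∃ λ n₀ → ∀ N → n₀ ≤ N → M * sum N E ≤ N

-- The exceptional set is only enclosed in the support of E, so that P need not
-- be decidable.
Most : ℕ → Pred ℕ p → Set p
Most M P = ∃ λ E → Small M E × (∀ n → E n ≡ 0 → P n)

-- The weight may vary with `M`, so no single null set of exceptions has to be built.
AE : Pred ℕ p → Set p
AE P = ∀ M → Most M P

Most-map : ∀ M → (∀ n → P n → P′ n) → Most M P → Most M P′
Most-map M f (E , small , ok) = E , small , λ n eq → f n (ok n eq)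

AE-map : (∀ n → P n → P′ n) → AE P → AE P′
AE-map f h M = Most-map M f (h M)

AE-universal : (∀ n → P n) → AE P
AE-universal p M = (λ _ → 0) , (0 , λ N _ → ≤-trans (≤-reflexive (lemma N)) z≤n) , λ n _ → p n
  where
  lemma : ∀ N → M * sum N (λ _ → 0) ≡ 0
  lemma N rewrite sum-const N 0 | *-zeroʳ N = *-zeroʳ M

Most-zip : ∀ M → Most (2 * M) P → Most (2 * M) P′ → Most M (λ n → P n × P′ n)
Most-zip M (E , (n₁ , h₁) , ok₁) (F , (n₂ , h₂) , ok₂) =
  (λ n → E n + F n) , (n₁ + n₂ , small) ,
  λ n eq → ok₁ n (m+n≡0⇒m≡0 (E n) eq) , ok₂ n (m+n≡0⇒n≡0 (E n) eq)
  where
  small : ∀ N → n₁ + n₂ ≤ N → M * sum N (λ n → E n + F n) ≤ N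
  small N le = *-cancelˡ-≤ 2 (begin
    2 * (M * sum N (λ n → E n + F n))   ≡⟨ cong (λ x → 2 * (M * x)) (sum-+ N E F) ⟩
    2 * (M * (sum N E + sum N F))       ≡⟨ lemma M (sum N E) (sum N F) ⟩
    2 * M * sum N E + 2 * M * sum N F   ≤⟨ +-mono-≤ (h₁ N (m+n≤o⇒m≤o n₁ le)) (h₂ N (m+n≤o⇒n≤o n₁ le)) ⟩
    N + N                               ≡⟨ cong (N +_) (+-identityʳ N) ⟨
    2 * N                               ∎)
    where
    open ≤-Reasoning
    lemma : ∀ M a b → 2 * (M * (a + b)) ≡ 2 * M * a + 2 * M * b
    lemma = solve-∀

AE-zip : AE P → AE P′ → AE (λ n → P n × P′ n)
AE-zip h h′ M = Most-zip M (h (2 * M)) (h′ (2 * M))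

AE-∀< : ∀ R {P : ℕ → Pred ℕ p} → (∀ r → r < R → AE (P r)) → AE (λ n → ∀ r → r < R → P r n)
AE-∀< zero    h = AE-universal λ n r ()
AE-∀< (suc R) {P} h = AE-map extend
  (AE-zip (AE-∀< R λ r r<R → h r (m<n⇒m<1+n r<R)) (h R ≤-refl))
  where
  extend : ∀ n → (∀ r → r < R → P r n) × P R n → ∀ r → r < suc R → P r n
  extend n (below , top) r r<1+R with m≤n⇒m<n∨m≡n (≤-pred r<1+R)
  ... | inj₁ r<R  = below r r<R
  ... | inj₂ refl = top

AE-∀Fin : ∀ {d} {P : Fin d → Pred ℕ p} → (∀ i → AE (P i)) → AE (λ n → ∀ i → P i n)
AE-∀Fin {d = zero}  h = AE-universal λ n ()
AE-∀Fin {d = suc d} {P} h = AE-map cases (AE-zip (h zero) (AE-∀Fin (h ∘ suc)))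
  where
  cases : ∀ n → P zero n × (∀ i → P (suc i) n) → ∀ i → P i n
  cases n (z , s) zero    = z
  cases n (z , s) (suc i) = s i

AE-dec→ : {A : Set a} → Dec A → (A → AE P) → AE (λ n → A → P n)
AE-dec→ (yes x) h = AE-map (λ n p _ → p) (h x)
AE-dec→ (no ¬x) h = AE-universal λ n x → ⊥-elim (¬x x)

sum-shift : ∀ c N g → sum N (λ n → g (n + c)) ≤ sum (N + c) g
sum-shift c N g = begin
  sum N (λ n → g (n + c))               ≡⟨ sum-cong N (λ n _ → cong g (+-comm n c)) ⟩
  sum N (λ n → g (c + n))               ≤⟨ m≤n+m _ _ ⟩
  sum c g + sum N (λ n → g (c + n))     ≡⟨ sum-split c N g ⟨
  sum (c + N) g                         ≡⟨ cong (λ x → sum x g) (+-comm c N) ⟩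
  sum (N + c) g                         ∎
  where open ≤-Reasoning

AE-shift : ∀ c → AE P → AE (λ n → P (n + c))
AE-shift c h M with h (2 * M)
... | E , (n₀ , small) , ok = (λ n → E (n + c)) , (n₀ + c , small′) , λ n → ok (n + c)
  where
  small′ : ∀ N → n₀ + c ≤ N → M * sum N (λ n → E (n + c)) ≤ N
  small′ N le = *-cancelˡ-≤ 2 (begin
    2 * (M * sum N (λ n → E (n + c)))   ≡⟨ *-assoc 2 M _ ⟨
    2 * M * sum N (λ n → E (n + c))     ≤⟨ *-monoʳ-≤ (2 * M) (sum-shift c N E) ⟩
    2 * M * sum (N + c) E               ≤⟨ small (N + c) (≤-trans (m+n≤o⇒m≤o n₀ le) (m≤m+n N c)) ⟩
    N + c                               ≤⟨ +-monoʳ-≤ N (m+n≤o⇒n≤o n₀ le) ⟩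
    N + N                               ≡⟨ cong (N +_) (+-identityʳ N) ⟨
    2 * N                               ∎)
    where open ≤-Reasoning

-- The `c` initial points are declared exceptional; once `2 * M * c ≤ N` they use at most half of
-- the allowed N/M.
Most-unshift : ∀ c M → Most (2 * M) (λ n → P (n + c)) → Most M P
Most-unshift {P = P} c M (E , (n₀ , small) , ok) = F , (c + n₀ + 2 * M * c , small′) , ok′
  where
  F : ℕ → ℕ
  F n with c ≤? n
  ... | yes _ = E (n ∸ c)
  ... | no _  = 1

  F-shift : ∀ n → F (c + n) ≡ E n
  F-shift n with c ≤? c + n
  ... | yes _  = cong E (m+n∸m≡n c n)
  ... | no c≰  = ⊥-elim (c≰ (m≤m+n c n))

  F-below : ∀ n → n < c → F n ≤ 1
  F-below n n<c with c ≤? n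
  ... | yes c≤n = ⊥-elim (<⇒≱ n<c c≤n)
  ... | no _    = ≤-refl

  ok′ : ∀ n → F n ≡ 0 → P n
  ok′ n eq with c ≤? n
  ... | yes c≤n = subst P (m∸n+n≡m c≤n) (ok (n ∸ c) eq)
  ok′ n () | no _

  small′ : ∀ N → c + n₀ + 2 * M * c ≤ N → M * sum N F ≤ N
  small′ N le with N′ , refl ← m≤n⇒∃[o]m+o≡n (≤-trans (m≤m+n c (n₀ + 2 * M * c))
                                  (≤-trans (≤-reflexive (sym (+-assoc c n₀ _))) le))
    = *-cancelˡ-≤ 2 (begin
    2 * (M * sum (c + N′) F)                             ≡⟨ *-assoc 2 M _ ⟨
    2 * M * sum (c + N′) F                               ≡⟨ cong (2 * M *_) (sum-split c N′ F) ⟩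
    2 * M * (sum c F + sum N′ (λ n → F (c + n)))         ≡⟨ cong (λ x → 2 * M * (sum c F + x)) (sum-cong N′ λ n _ → F-shift n) ⟩
    2 * M * (sum c F + sum N′ E)                         ≡⟨ *-distribˡ-+ (2 * M) (sum c F) _ ⟩
    2 * M * sum c F + 2 * M * sum N′ E                   ≤⟨ +-mono-≤ (*-monoʳ-≤ (2 * M) below) (small N′ n₀≤N′) ⟩
    2 * M * c + N′                                       ≤⟨ +-mono-≤ (m+n≤o⇒n≤o (c + n₀) le) (m≤n+m N′ c) ⟩
    c + N′ + (c + N′)                                    ≡⟨ cong (c + N′ +_) (+-identityʳ _) ⟨
    2 * (c + N′)                                         ∎)
    where
    open ≤-Reasoning
    n₀≤N′ : n₀ ≤ N′
    n₀≤N′ = +-cancelˡ-≤ c _ _ (≤-trans (m≤m+n (c + n₀) (2 * M * c)) le)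
    below : sum c F ≤ c
    below = ≤-trans (sum-mono-≤ c F-below) (≤-reflexive (trans (sum-const c 1) (*-identityʳ c)))

-- A residue class modulo `B` has density 1/B, so the density of exceptions within it grows at most
-- by the factor `B`.
AE-dilate : ∀ B r → r < B → AE P → AE (λ n → P (B * n + r))
AE-dilate B r r<B h M with h (B * M)
... | E , (n₀ , small) , ok = (λ n → E (B * n + r)) , (n₀ , small′) , λ n → ok (B * n + r)
  where
  instance _ = >-nonZero (≤-trans (s≤s z≤n) r<B)
  small′ : ∀ N → n₀ ≤ N → M * sum N (λ n → E (B * n + r)) ≤ N
  small′ N le = *-cancelˡ-≤ B (begin
    B * (M * sum N (λ n → E (B * n + r)))                   ≡⟨ *-assoc B M _ ⟨
    B * M * sum N (λ n → E (B * n + r))                     ≤⟨ *-monoʳ-≤ (B * M) (sum-mono-≤ N λ n _ → term≤sum B (λ r → E (B * n + r)) r<B) ⟩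
    B * M * sum N (λ n → sum B (λ r → E (B * n + r)))       ≡⟨ cong (B * M *_) (sum-blocks B N E) ⟨
    B * M * sum (B * N) E                                   ≤⟨ small (B * N) (≤-trans le (m≤n*m N B)) ⟩
    B * N                                                   ∎)
    where open ≤-Reasoning

-- Division into blocks of length `B`

module _ (B : ℕ) .{{_ : NonZero B}} where

  m≡B*[m/B]+m%B : ∀ m → m ≡ B * (m / B) + m % B
  m≡B*[m/B]+m%B m = trans (m≡m%n+[m/n]*n m B)
    (trans (+-comm (m % B) _) (cong (_+ m % B) (*-comm (m / B) B)))

  [B*n+r]/B≡n : ∀ n {r} → r < B → (B * n + r) / B ≡ n
  [B*n+r]/B≡n n {r} r<B = begin
    (B * n + r) / B       ≡⟨ +-distrib-/-∣ˡ r (m∣m*n n) ⟩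
    B * n / B + r / B     ≡⟨ cong₂ _+_ (trans (cong (_/ B) (*-comm B n)) (m*n/n≡m n B)) (m<n⇒m/n≡0 r<B) ⟩
    n + 0                 ≡⟨ +-identityʳ n ⟩
    n                     ∎
    where open ≡-Reasoning

  [B*n+r]%B≡r : ∀ n {r} → r < B → (B * n + r) % B ≡ r
  [B*n+r]%B≡r n {r} r<B = begin
    (B * n + r) % B       ≡⟨ cong (_% B) (trans (+-comm (B * n) r) (cong (r +_) (*-comm B n))) ⟩
    (r + n * B) % B       ≡⟨ [m+kn]%n≡m%n r n B ⟩
    r % B                 ≡⟨ m<n⇒m%n≡m r<B ⟩
    r                     ∎
    where open ≡-Reasoning

  N≤B*[1+N/B] : ∀ N → N ≤ B * suc (N / B)
  N≤B*[1+N/B] N = begin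
    N                       ≡⟨ m≡B*[m/B]+m%B N ⟩
    B * (N / B) + N % B     ≤⟨ +-monoʳ-≤ _ (<⇒≤ (m%n<n N B)) ⟩
    B * (N / B) + B         ≡⟨ trans (+-comm _ B) (sym (*-suc B (N / B))) ⟩
    B * suc (N / B)         ∎
    where open ≤-Reasoning

  B*[1+N/B]≤2*N : ∀ N → B ≤ N → B * suc (N / B) ≤ 2 * N
  B*[1+N/B]≤2*N N B≤N = begin
    B * suc (N / B)         ≡⟨ *-suc B (N / B) ⟩
    B + B * (N / B)         ≤⟨ +-mono-≤ B≤N (≤-trans (≤-reflexive (*-comm B _)) (m/n*n≤m N B)) ⟩
    N + N                   ≡⟨ cong (N +_) (+-identityʳ N) ⟨
    2 * N                   ∎
    where open ≤-Reasoning

  sum-≤-blocks : ∀ N g → sum N g ≤ sum (suc (N / B)) (λ n → sum B (λ r → g (B * n + r)))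
  sum-≤-blocks N g = ≤-trans (sum-monoˡ-≤ g (N≤B*[1+N/B] N))
    (≤-reflexive (sum-blocks B (suc (N / B)) g))

  -- The last block is counted in full even where `N` cuts it; for `B ≤ N` this at most doubles the
  -- length, whence the factor 2.
  Small-blocks : ∀ M e E → (∀ x → sum B (λ t → E (B * x + t)) ≤ e) → 2 * M * e ≤ B → Small M E
  Small-blocks M e E block≤e 2Me≤B = B , λ N B≤N → *-cancelˡ-≤ 2 (begin
    2 * (M * sum N E)               ≡⟨ *-assoc 2 M _ ⟨
    2 * M * sum N E                 ≤⟨ *-monoʳ-≤ (2 * M) (≤-trans (sum-≤-blocks N E) (≤-trans (sum-mono-≤ (suc (N / B)) (λ x _ → block≤e x)) (≤-reflexive (sum-const (suc (N / B)) e)))) ⟩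
    2 * M * (suc (N / B) * e)       ≡⟨ lemma (2 * M) (suc (N / B)) e ⟩
    2 * M * e * suc (N / B)         ≤⟨ *-monoˡ-≤ (suc (N / B)) 2Me≤B ⟩
    B * suc (N / B)                 ≤⟨ B*[1+N/B]≤2*N N B≤N ⟩
    2 * N                           ∎)
    where
    open ≤-Reasoning
    lemma : ∀ a b c → a * (b * c) ≡ a * c * b
    lemma = solve-∀

  Most-/ : ∀ M → Most (2 * M) P → Most M (λ m → P (m / B))
  Most-/ M (E , (n₀ , small) , ok) = (λ m → E (m / B)) , (B * n₀ + B , small′) , λ m → ok (m / B)
    where
    small′ : ∀ N → B * n₀ + B ≤ N → M * sum N (λ m → E (m / B)) ≤ N
    small′ N le = *-cancelˡ-≤ 2 (begin
      2 * (M * sum N (λ m → E (m / B)))   ≡⟨ *-assoc 2 M _ ⟨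
      2 * M * sum N (λ m → E (m / B))     ≤⟨ *-monoʳ-≤ (2 * M) (≤-trans (sum-≤-blocks N _) (≤-reflexive blocks)) ⟩
      2 * M * (B * sum (suc (N / B)) E)   ≡⟨ lemma (2 * M) B _ ⟩
      B * (2 * M * sum (suc (N / B)) E)   ≤⟨ *-monoʳ-≤ B (small (suc (N / B)) n₀≤) ⟩
      B * suc (N / B)                     ≤⟨ B*[1+N/B]≤2*N N (m+n≤o⇒n≤o (B * n₀) le) ⟩
      2 * N                               ∎)
      where
      open ≤-Reasoning
      lemma : ∀ a b c → a * (b * c) ≡ b * (a * c)
      lemma = solve-∀
      n₀≤ : n₀ ≤ suc (N / B)
      n₀≤ = *-cancelˡ-≤ B (≤-trans (m+n≤o⇒m≤o (B * n₀) le) (N≤B*[1+N/B] N))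
      blocks : sum (suc (N / B)) (λ n → sum B (λ r → E ((B * n + r) / B))) ≡ B * sum (suc (N / B)) E
      blocks = trans (sum-cong (suc (N / B)) λ n _ →
        trans (sum-cong B λ r r<B → cong E ([B*n+r]/B≡n n r<B)) (sum-const B (E n)))
        (sum-*ˡ B (suc (N / B)) E)

  AE-/ : AE P → AE (λ m → P (m / B))
  AE-/ h M = Most-/ M (h (2 * M))

-- Indicators and upper density

𝟙 : {A : Set a} → Dec A → ℕ
𝟙 (yes _) = 1
𝟙 (no _)  = 0

𝟙≤1 : {A : Set a} (A? : Dec A) → 𝟙 A? ≤ 1
𝟙≤1 (yes _) = ≤-refl
𝟙≤1 (no _)  = z≤n

𝟙-¬ : {A : Set a} (A? : Dec A) → ¬ A → 𝟙 A? ≡ 0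
𝟙-¬ (yes x) ¬x = ⊥-elim (¬x x)
𝟙-¬ (no _)  ¬x = refl

𝟙≡0⇒¬ : {A : Set a} (A? : Dec A) → 𝟙 A? ≡ 0 → ¬ A
𝟙≡0⇒¬ (no ¬x) _ = ¬x

𝟙-mono : {A : Set a} {B : Set p} (A? : Dec A) (B? : Dec B) → (A → B) → 𝟙 A? ≤ 𝟙 B?
𝟙-mono (no _)  B?      f = z≤n
𝟙-mono (yes x) (yes _) f = ≤-refl
𝟙-mono (yes x) (no ¬y) f = ⊥-elim (¬y (f x))

count≡sum : {A : Pred ℕ p} (A? : Decidable A) → ∀ N → count A? N ≡ sum N (λ n → 𝟙 (A? n))
count≡sum A? zero    = refl
count≡sum A? (suc N) = begin
  length (filter A? (upTo (suc N)))                                ≡⟨ cong (length ∘ filter A?) (upTo-∷ʳ N) ⟨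
  length (filter A? (upTo N ++ N ∷ []))             ≡⟨ cong length (filter-++ A? (upTo N) (N ∷ [])) ⟩
  length (filter A? (upTo N) ++ filter A? (N ∷ [])) ≡⟨ length-++ (filter A? (upTo N)) ⟩
  count A? N + length (filter A? (N ∷ []))                         ≡⟨ cong₂ _+_ (count≡sum A? N) last ⟩
  sum N (λ n → 𝟙 (A? n)) + 𝟙 (A? N)                                ∎
  where
  open ≡-Reasoning
  last : length (filter A? (N ∷ [])) ≡ 𝟙 (A? N)
  last with A? N
  ... | yes _ = refl
  ... | no _  = refl

-- `ℚᵘ.mkℚᵘ (ℤ.+ 1) M` is 1/(M+1), a positive ε even for `M` = 0.
frequency<⇒ : ∀ x n M → (ℤ.+ x) ℚᵘ./ suc n ℚᵘ.< ℚᵘ.0ℚᵘ ℚᵘ.+ ℚᵘ.mkℚᵘ (ℤ.+ 1) M → M * x ≤ suc n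
frequency<⇒ x n M lt
  with ℚᵘ.*<* lt′ ← subst ((ℤ.+ x) ℚᵘ./ suc n ℚᵘ.<_) (ℚᵘ.+-identityˡ-≡ (ℚᵘ.mkℚᵘ (ℤ.+ 1) M)) lt
  = begin
  M * x         ≤⟨ *-monoˡ-≤ x (n≤1+n M) ⟩
  suc M * x     ≡⟨ *-comm (suc M) x ⟩
  x * suc M     ≤⟨ <⇒≤ (ℤ.drop‿+<+ (subst₂ ℤ._<_ (sym (ℤ.pos-* x (suc M))) (ℤ.*-identityˡ (ℤ.+ suc n)) lt′)) ⟩
  suc n         ∎
  where open ≤-Reasoning

-- Here ε is (c+1)/(d+1), and a frequency of at most 1/(d+2) lies strictly below it.
frequency<⇐ : ∀ x n c d → suc (suc d) * x ≤ suc n →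
  (ℤ.+ x) ℚᵘ./ suc n ℚᵘ.< ℚᵘ.0ℚᵘ ℚᵘ.+ ℚᵘ.mkℚᵘ (ℤ.+ suc c) d
frequency<⇐ x n c d le =
  subst ((ℤ.+ x) ℚᵘ./ suc n ℚᵘ.<_) (sym (ℚᵘ.+-identityˡ-≡ (ℚᵘ.mkℚᵘ (ℤ.+ suc c) d))) (ℚᵘ.*<*
    (subst₂ ℤ._<_ (ℤ.pos-* x (suc d)) (ℤ.pos-* (suc c) (suc n))
      (ℤ.+<+ (<-≤-trans (strict x le) (m≤m+n (suc n) (c * suc n))))))
  where
  strict : ∀ x → suc (suc d) * x ≤ suc n → x * suc d < suc n
  strict zero    _  = z<s
  strict (suc x) le = <-≤-trans (*-monoʳ-< (suc x) ≤-refl) (≤-trans (≤-reflexive (*-comm (suc x) _)) le)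

AlmostAll⇒AE : (P? : Decidable P) → AlmostAll P? → AE P
AlmostAll⇒AE {P = P} P? h M with proj₁ (h (ℚᵘ.mkℚᵘ (ℤ.+ 1) M) (ℚᵘ.*<* (ℤ.+<+ (s≤s z≤n))))
... | n₀ , below = (λ n → 𝟙 (¬? (P? n))) , (suc n₀ , small) , λ n eq →
  decidable-stable (P? n) (𝟙≡0⇒¬ (¬? (P? n)) eq)
  where
  small : ∀ N → suc n₀ ≤ N → M * sum N (λ n → 𝟙 (¬? (P? n))) ≤ N
  small (suc n) (s≤s le) = subst (λ x → M * x ≤ suc n) (count≡sum (¬? ∘ P?) (suc n))
    (frequency<⇒ _ n M (below n le))

AE⇒AlmostAll : (P? : Decidable P) → AE P → AlmostAll P?
AE⇒AlmostAll P? h (ℚᵘ.mkℚᵘ (ℤ.+ zero) d) (ℚᵘ.*<* (ℤ.+<+ ()))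
AE⇒AlmostAll P? h (ℚᵘ.mkℚᵘ (ℤ.-[1+ _ ]) d) (ℚᵘ.*<* ())
AE⇒AlmostAll P? h ε@(ℚᵘ.mkℚᵘ (ℤ.+ suc c) d) _ with h (suc (suc d))
... | E , (n₀ , small) , ok =
  -- Frequencies are non-negative, so the second half of `IsLimsup` holds at every index.
  (n₀ , λ n n₀≤n → frequency<⇐ _ n c d (bound n n₀≤n)) , λ n₁ → n₁ , ≤-refl , lower n₁
  where
  exceptions≤E : ∀ n → 𝟙 (¬? (P? n)) ≤ E n
  exceptions≤E n with P? n
  ... | yes _ = z≤n
  ... | no ¬x = n≢0⇒n>0 (¬x ∘ ok n)

  bound : ∀ n → n₀ ≤ n → suc (suc d) * count (¬? ∘ P?) (suc n) ≤ suc n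
  bound n n₀≤n = ≤-trans (*-monoʳ-≤ (suc (suc d)) (≤-trans (≤-reflexive (count≡sum (¬? ∘ P?) (suc n)))
    (sum-mono-≤ (suc n) λ n _ → exceptions≤E n))) (small (suc n) (m≤n⇒m≤1+n n₀≤n))

  lower : ∀ n → ℚᵘ.0ℚᵘ ℚᵘ.- ε ℚᵘ.< (ℤ.+ count (¬? ∘ P?) (suc n)) ℚᵘ./ suc n
  lower n = ℚᵘ.<-≤-trans
    (subst (ℚᵘ._< ℚᵘ.0ℚᵘ) (sym (ℚᵘ.+-identityˡ-≡ (ℚᵘ.- ε))) (ℚᵘ.*<* ℤ.-<+))
    (ℚᵘ.*≤* (subst₂ ℤ._≤_ refl (ℤ.pos-* (count (¬? ∘ P?) (suc n)) 1) (ℤ.+≤+ z≤n)))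

-- Repetitions in a finite colouring

sum-swap : ∀ M N (g : ℕ → ℕ → ℕ) → sum M (λ m → sum N (λ n → g n m)) ≡ sum N (λ n → sum M (g n))
sum-swap M zero    g = trans (sum-const M 0) (*-zeroʳ M)
sum-swap M (suc N) g = trans (sum-+ M _ _) (cong (_+ sum M (g N)) (sum-swap M N g))

Repeats : (ℕ → ℕ) → ℕ → Set
Repeats c t = ∃ λ (u : Fin t) → c (toℕ u) ≡ c t

repeats? : ∀ c → Decidable (Repeats c)
repeats? c t = Fin.any? λ u → c (toℕ u) ≟ c t

fresh : (ℕ → ℕ) → ℕ → ℕ
fresh c t = 𝟙 (¬? (repeats? c t))

-- Double counting: a fresh time is the first occurrence of its value, and each of the `D` possible
-- values has at most one first occurrence.
sum-fresh≤ : ∀ D c H → (∀ t → c t < D) → sum H (fresh c) ≤ D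
sum-fresh≤ D c H c<D = begin
  sum H (fresh c)                                ≤⟨ sum-mono-≤ H (λ t _ → fresh≤ t) ⟩
  sum H (λ t → sum D (λ a → first a t))          ≡⟨ sum-swap H D first ⟩
  sum D (λ a → sum H (first a))                  ≤⟨ sum-mono-≤ D (λ a _ → first≤1 a H) ⟩
  sum D (λ _ → 1)                                ≡⟨ trans (sum-const D 1) (*-identityʳ D) ⟩
  D                                              ∎
  where
  open ≤-Reasoning
  first? : ∀ a t → Dec (c t ≡ a × ¬ Repeats c t)
  first? a t = (c t ≟ a) ×-dec ¬? (repeats? c t)

  first : ℕ → ℕ → ℕ
  first a t = 𝟙 (first? a t)

  fresh≤ : ∀ t → fresh c t ≤ sum D (λ a → first a t)
  fresh≤ t = ≤-trans (𝟙-mono (¬? (repeats? c t)) (first? (c t) t) (refl ,_))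
    (term≤sum D (λ a → first a t) (c<D t))

  first≤1 : ∀ a H → sum H (first a) ≤ 1
  first≤1 a zero    = z≤n
  first≤1 a (suc H) with first? a H
  ... | no _ = ≤-trans (≤-reflexive (+-identityʳ _)) (first≤1 a H)
  ... | yes (cH≡a , new) = ≤-reflexive (cong (_+ 1) none-before)
    where
    none-before : sum H (first a) ≡ 0
    none-before = trans (sum-cong H λ t t<H → 𝟙-¬ (first? a t) λ (ct≡a , _) →
        new (fromℕ< t<H , trans (cong c (Fin.toℕ-fromℕ< t<H)) (trans ct≡a (sym cH≡a))))
      (trans (sum-const H 0) (*-zeroʳ H))

-- Diophantine lemmas

m<l^m : ∀ {l} → 1 < l → ∀ m → m < l ^ m
m<l^m 1<l zero    = ≤-refl
m<l^m {l} 1<l (suc m) = begin-strict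
  suc m        ≤⟨ m<l^m 1<l m ⟩
  l ^ m        <⟨ m<m*n (l ^ m) l {{>-nonZero (≤-<-trans z≤n (m<l^m 1<l m))}} 1<l ⟩
  l ^ m * l    ≡⟨ *-comm (l ^ m) l ⟩
  l * l ^ m    ∎
  where open ≤-Reasoning

∃-floor-log : ∀ {l} → 1 < l → ∀ n → ∃ λ j → l ^ j ≤ suc n × suc n < l ^ suc j
∃-floor-log {l} 1<l zero = 0 , ≤-refl , ≤-trans 1<l (≤-reflexive (sym (*-identityʳ l)))
∃-floor-log {l} 1<l (suc n) with ∃-floor-log 1<l n
... | j , lo , hi with m≤n⇒m<n∨m≡n hi
... | inj₁ lt = j , m≤n⇒m≤1+n lo , lt
... | inj₂ eq = suc j , ≤-reflexive (sym eq) , (begin-strict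
  suc (suc n)          ≡⟨ eq ⟩
  l ^ suc j            <⟨ ^-monoʳ-< l 1<l (n<1+n (suc j)) ⟩
  l ^ suc (suc j)      ∎)
  where open ≤-Reasoning

Distance : ℕ → ℕ → ℕ → Set
Distance K L δ = (K ≡ L + δ) ⊎ (L ≡ K + δ)

-- Dirichlet's argument in multiplicative form: two of the quotients `k ^ i / l ^ lg i`, all in [1,
-- l), fall into the same cell of length 1/C⁺, and dividing one by the other gives powers whose
-- ratio is close to 1. Independence excludes the ratio 1 itself.
∃-close-powers : ∀ {k l} → 1 < k → 1 < l → MultiplicativelyIndependent k l →
  ∀ C → ∃₂ λ α β → ∃ λ δ → 1 ≤ δ × Distance (k ^ α) (l ^ β) δ × suc C * δ ≤ k ^ α
∃-close-powers {k} {l} 1<k 1<l indep C = conclusion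
  where
  instance
    k≢0 : NonZero k
    k≢0 = >-nonZero (<⇒≤ 1<k)
    l≢0 : NonZero l
    l≢0 = >-nonZero (<⇒≤ 1<l)

  C⁺ = suc C

  ∃log : ∀ i → ∃ λ j → l ^ j ≤ k ^ i × k ^ i < l ^ suc j
  ∃log i = subst (λ n → ∃ λ j → l ^ j ≤ n × n < l ^ suc j) (suc-pred (k ^ i) {{m^n≢0 k i}})
    (∃-floor-log 1<l (pred (k ^ i)))

  lg : ℕ → ℕ
  lg i = proj₁ (∃log i)

  l^lg≢0 : ∀ i → NonZero (l ^ lg i)
  l^lg≢0 i = m^n≢0 l (lg i)

  -- The cell of `k ^ i / l ^ lg i`, in units of 1/C⁺.
  x : ℕ → ℕ
  x i = _/_ (C⁺ * k ^ i) (l ^ lg i) {{l^lg≢0 i}}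

  x<l*C : ∀ i → x i < l * C⁺
  x<l*C i = m<n*o⇒m/o<n {{l^lg≢0 i}} (begin-strict
    C⁺ * k ^ i              <⟨ *-monoʳ-< C⁺ (proj₂ (proj₂ (∃log i))) ⟩
    C⁺ * (l * l ^ lg i)     ≡⟨ *-assoc C⁺ l _ ⟨
    C⁺ * l * l ^ lg i       ≡⟨ cong (_* l ^ lg i) (*-comm C⁺ l) ⟩
    l * C⁺ * l ^ lg i       ∎)
    where open ≤-Reasoning

  C≤x : ∀ i → C⁺ ≤ x i
  C≤x i = subst (_≤ x i) (m*n/n≡m C⁺ (l ^ lg i) {{l^lg≢0 i}})
    (/-monoˡ-≤ (l ^ lg i) {{l^lg≢0 i}} (*-monoʳ-≤ C⁺ (proj₁ (proj₂ (∃log i)))))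

  x-lower : ∀ i → x i * l ^ lg i ≤ C⁺ * k ^ i
  x-lower i = m/n*n≤m _ _ {{l^lg≢0 i}}

  x-upper : ∀ i → C⁺ * k ^ i < suc (x i) * l ^ lg i
  x-upper i = begin-strict
    C⁺ * k ^ i                                        ≡⟨ m≡m%n+[m/n]*n (C⁺ * k ^ i) (l ^ lg i) ⟩
    C⁺ * k ^ i % l ^ lg i + x i * l ^ lg i            <⟨ +-monoˡ-< _ (m%n<n (C⁺ * k ^ i) (l ^ lg i)) ⟩
    suc (x i) * l ^ lg i                              ∎
    where
    open ≤-Reasoning
    instance _ = l^lg≢0 i


  conclusion : ∃₂ λ α β → ∃ λ δ → 1 ≤ δ × Distance (k ^ α) (l ^ β) δ × C⁺ * δ ≤ k ^ α
  conclusion with Fin.pigeonhole {l * C⁺} ≤-refl (λ i → fromℕ< (x<l*C (toℕ i)))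
  ... | fi , fi′ , fi<fi′ , eq with m≤n⇒∃[o]m+o≡n (<⇒≤ fi<fi′)
  ... | α , i+α≡i′ = α , β , close (<-cmp (k ^ α) (l ^ β))
    where
    open ≤-Reasoning
    i  = toℕ fi
    i′ = toℕ fi′
    y  = x i

    xi≡xi′ : x i ≡ x i′
    xi≡xi′ = trans (sym (Fin.toℕ-fromℕ< (x<l*C i))) (trans (cong toℕ eq) (Fin.toℕ-fromℕ< (x<l*C i′)))

    lgi≤lgi′ : lg i ≤ lg i′
    lgi≤lgi′ = ≮⇒≥ λ lt → <-irrefl refl (begin-strict
      l ^ lg i        ≤⟨ proj₁ (proj₂ (∃log i)) ⟩
      k ^ i           ≤⟨ ^-monoʳ-≤ k (<⇒≤ fi<fi′) ⟩
      k ^ i′          <⟨ proj₂ (proj₂ (∃log i′)) ⟩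
      l ^ suc (lg i′) ≤⟨ ^-monoʳ-≤ l lt ⟩
      l ^ lg i        ∎)

    β : ℕ
    β = proj₁ (m≤n⇒∃[o]m+o≡n lgi≤lgi′)

    k-split : k ^ i′ ≡ k ^ i * k ^ α
    k-split = trans (cong (k ^_) (sym i+α≡i′)) (^-distribˡ-+-* k i α)

    l-split : l ^ lg i′ ≡ l ^ lg i * l ^ β
    l-split = trans (cong (l ^_) (sym (proj₂ (m≤n⇒∃[o]m+o≡n lgi≤lgi′)))) (^-distribˡ-+-* l (lg i) β)

    rot : ∀ a b c → a * b * c ≡ b * (a * c)
    rot = solve-∀

    -- Both scaled quotients lie in [y, y+1), so the ratio of `k ^ α` to `l ^ β` is below (y+1)/y;
    -- `lower` is the inverse bound.
    upper : y * k ^ α < suc y * l ^ β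
    upper = *-cancelˡ-< (l ^ lg i) _ _ (begin-strict
      l ^ lg i * (y * k ^ α)              ≡⟨ rot y (l ^ lg i) (k ^ α) ⟨
      y * l ^ lg i * k ^ α                ≤⟨ *-monoˡ-≤ (k ^ α) (x-lower i) ⟩
      C⁺ * k ^ i * k ^ α                  ≡⟨ *-assoc C⁺ (k ^ i) (k ^ α) ⟩
      C⁺ * (k ^ i * k ^ α)                ≡⟨ cong (C⁺ *_) k-split ⟨
      C⁺ * k ^ i′                         <⟨ x-upper i′ ⟩
      suc (x i′) * l ^ lg i′              ≡⟨ cong₂ (λ u v → suc u * v) (sym xi≡xi′) l-split ⟩
      suc y * (l ^ lg i * l ^ β)          ≡⟨ *-assoc (suc y) (l ^ lg i) (l ^ β) ⟨
      suc y * l ^ lg i * l ^ β            ≡⟨ rot (suc y) (l ^ lg i) (l ^ β) ⟩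
      l ^ lg i * (suc y * l ^ β)          ∎)

    lower : y * l ^ β < suc y * k ^ α
    lower = *-cancelˡ-< (l ^ lg i) _ _ (begin-strict
      l ^ lg i * (y * l ^ β)              ≡⟨ rot y (l ^ lg i) (l ^ β) ⟨
      y * l ^ lg i * l ^ β                ≡⟨ *-assoc y (l ^ lg i) (l ^ β) ⟩
      y * (l ^ lg i * l ^ β)              ≡⟨ cong₂ _*_ xi≡xi′ (sym l-split) ⟩
      x i′ * l ^ lg i′                    ≤⟨ x-lower i′ ⟩
      C⁺ * k ^ i′                         ≡⟨ cong (C⁺ *_) k-split ⟩
      C⁺ * (k ^ i * k ^ α)                ≡⟨ *-assoc C⁺ (k ^ i) (k ^ α) ⟨
      C⁺ * k ^ i * k ^ α                  <⟨ *-monoˡ-< (k ^ α) {{m^n≢0 k α}} (x-upper i) ⟩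
      suc y * l ^ lg i * k ^ α            ≡⟨ rot (suc y) (l ^ lg i) (k ^ α) ⟩
      l ^ lg i * (suc y * k ^ α)          ∎)

    -- `S` is the smaller power. The hypothesis leaves `y * δ < S`, and `y` is at least `C⁺`.
    gap : ∀ S δ → y * (S + δ) < suc y * S → C⁺ * δ ≤ S
    gap S δ lt = ≤-trans (*-monoˡ-≤ δ (C≤x i)) (<⇒≤ (+-cancelˡ-< (y * S) _ _ (begin-strict
      y * S + y * δ   ≡⟨ *-distribˡ-+ y S δ ⟨
      y * (S + δ)     <⟨ lt ⟩
      suc y * S       ≡⟨ +-comm S (y * S) ⟩
      y * S + S       ∎)))

    1≤α : 1 ≤ α
    1≤α = n≢0⇒n>0 λ { refl → <-irrefl (trans (sym (+-identityʳ i)) i+α≡i′) fi<fi′ }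

    close : Tri (k ^ α < l ^ β) (k ^ α ≡ l ^ β) (k ^ α > l ^ β) →
      ∃ λ δ → 1 ≤ δ × Distance (k ^ α) (l ^ β) δ × C⁺ * δ ≤ k ^ α
    close (tri< lt _ _) with m≤n⇒∃[o]m+o≡n lt
    ... | δ , eq = suc δ , s≤s z≤n , inj₂ l^β≡ ,
      gap (k ^ α) (suc δ) (subst (λ z → y * z < suc y * k ^ α) l^β≡ lower)
      where
      l^β≡ : l ^ β ≡ k ^ α + suc δ
      l^β≡ = trans (sym eq) (sym (+-suc (k ^ α) δ))
    close (tri≈ _ eq′ _) = ⊥-elim (indep (β , α , 1≤β , 1≤α , eq′))
      where
      1≤β : 1 ≤ β
      1≤β = n≢0⇒n>0 λ β≡0 → <-irrefl (sym (trans eq′ (cong (l ^_) β≡0)))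
        (^-monoʳ-< k 1<k 1≤α)
    close (tri> _ _ gt) with m≤n⇒∃[o]m+o≡n gt
    ... | δ , eq = suc δ , s≤s z≤n , inj₁ k^α≡ , ≤-trans
      (gap (l ^ β) (suc δ) (subst (λ z → y * z < suc y * l ^ β) k^α≡ upper)) (<⇒≤ gt)
      where
      k^α≡ : k ^ α ≡ l ^ β + suc δ
      k^α≡ = trans (sym eq) (sym (+-suc (l ^ β) δ))

-- The left side divides `p` and also gcd(np, nm) = gcd(p, m) n, hence the gcd of gcd(p, m) p and
-- gcd(p, m) n.
gcd[p,m*n]∣gcd[p,m]*gcd[p,n] : ∀ p m n → gcd p (m * n) ∣ gcd p m * gcd p n
gcd[p,m*n]∣gcd[p,m]*gcd[p,n] p m n =
  subst (c ∣_) (sym (c*gcd[m,n]≡gcd[cm,cn] (gcd p m) p n))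
    (gcd-greatest (∣n⇒∣m*n (gcd p m) c∣p) c∣gcd[p,m]*n)
  where
  c = gcd p (m * n)
  c∣p : c ∣ p
  c∣p = gcd[m,n]∣m p (m * n)
  c∣gcd[p,m]*n : c ∣ gcd p m * n
  c∣gcd[p,m]*n = subst (c ∣_) (trans (sym (c*gcd[m,n]≡gcd[cm,cn] n p m)) (*-comm n _))
    (gcd-greatest (∣n⇒∣m*n n c∣p) (subst (c ∣_) (*-comm m n) (gcd[m,n]∣n p (m * n))))

-- A proper divisor of k is at most k/2, and gcd(p, k^A) divides gcd(p, k)^A.
gcd[p,k^A]*2^A≤k^A : ∀ {k p} .{{_ : NonZero k}} → ¬ k ∣ p → ∀ A → gcd p (k ^ A) * 2 ^ A ≤ k ^ A
gcd[p,k^A]*2^A≤k^A {k} {p} k∤p zero = ≤-trans (≤-reflexive (*-identityʳ _)) (∣⇒≤ (gcd[m,n]∣n p 1))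
gcd[p,k^A]*2^A≤k^A {k} {p} k∤p (suc A) = begin
  gcd p (k * k ^ A) * (2 * 2 ^ A)                 ≤⟨ *-monoˡ-≤ (2 * 2 ^ A) (∣⇒≤ {{nz}} (gcd[p,m*n]∣gcd[p,m]*gcd[p,n] p k (k ^ A))) ⟩
  gcd p k * gcd p (k ^ A) * (2 * 2 ^ A)           ≡⟨ lemma (gcd p k) (gcd p (k ^ A)) (2 ^ A) ⟩
  gcd p k * 2 * (gcd p (k ^ A) * 2 ^ A)           ≤⟨ *-mono-≤ half (gcd[p,k^A]*2^A≤k^A k∤p A) ⟩
  k * k ^ A                                       ∎
  where
  open ≤-Reasoning
  lemma : ∀ a b c → a * b * (2 * c) ≡ a * 2 * (b * c)
  lemma = solve-∀
  nz : NonZero (gcd p k * gcd p (k ^ A))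
  nz = m*n≢0 _ _ {{≢-nonZero (gcd[m,n]≢0 p k (inj₂ (≢-nonZero⁻¹ k)))}}
                 {{≢-nonZero (gcd[m,n]≢0 p (k ^ A) (inj₂ (≢-nonZero⁻¹ _ {{m^n≢0 k A}})))}}
  half : gcd p k * 2 ≤ k
  half with gcd[m,n]∣n p k
  ... | divides zero          eq = ⊥-elim (≢-nonZero⁻¹ k eq)
  ... | divides (suc zero)    eq = ⊥-elim (k∤p (subst (_∣ p) (sym (trans eq (+-identityʳ _))) (gcd[m,n]∣m p k)))
  ... | divides (suc (suc c)) eq = ≤-trans (≤-reflexive (*-comm (gcd p k) 2))
    (≤-trans (*-monoˡ-≤ (gcd p k) {2} {suc (suc c)} (s≤s (s≤s z≤n))) (≤-reflexive (sym eq)))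

∃-round-up : ∀ g D → ∃₂ λ c w → w < suc g × suc g * c ≡ D + w
∃-round-up g zero = 0 , 0 , s≤s z≤n , *-zeroʳ g
∃-round-up g (suc D) with ∃-round-up g D
... | c , suc w , w< , eq = c , w , <⇒≤ w< , trans eq (+-suc D w)
... | c , zero  , w< , eq = suc c , g , ≤-refl , trans (*-suc (suc g) c)
  (trans (cong (suc g +_) (trans eq (+-identityʳ D))) (trans (+-comm (suc g) D) (+-suc D g)))

-- The multiples of p modulo Q have gaps gcd p Q, so they meet every interval
-- of length W ≥ gcd p Q.
∃-multiple-in-interval : ∀ {p Q} W .{{_ : NonZero Q}} → gcd p Q ≤ W →
  ∀ τ → τ + W ≤ Q → ∀ y → ∃₂ λ j n → ∃ λ w → j < Q × w < W × y + j * p ≡ Q * n + (τ + w)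
∃-multiple-in-interval {p} {Q} W g≤W τ τ+W≤Q y =
  j , (y + j * p) / Q , w , m%n<n _ Q , <-≤-trans w<g (≤-trans (≤-reflexive g⁺≡g) g≤W) , (begin
    y + j * p                                             ≡⟨ m≡B*[m/B]+m%B Q (y + j * p) ⟩
    Q * ((y + j * p) / Q) + (y + j * p) % Q               ≡⟨ cong (Q * ((y + j * p) / Q) +_) residue ⟩
    Q * ((y + j * p) / Q) + (τ + w)                       ∎)
  where
  open ≡-Reasoning
  g = gcd p Q

  g⁺≡g : suc (pred g) ≡ g
  g⁺≡g = suc-pred g {{≢-nonZero (gcd[m,n]≢0 p Q (inj₂ (≢-nonZero⁻¹ Q)))}}

  ∃-inverse : ∃₂ λ j₀ e → ∃ λ e′ → j₀ * p + e * Q ≡ g + e′ * Q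
  ∃-inverse with Bézout.identity (gcd-GCD p Q)
  ... | Bézout.+- u v eq = u , 0 , v , trans (+-identityʳ _) (sym eq)
  -- Here `u * p` is congruent to `-g` modulo `Q`; the factor `pred Q` stands for -1.
  ... | Bézout.-+ u v eq = pred Q * u , v , u * p , (begin
    pred Q * u * p + v * Q           ≡⟨ cong (pred Q * u * p +_) (sym eq) ⟩
    pred Q * u * p + (g + u * p)     ≡⟨ lemma (pred Q) u p g ⟩
    g + u * p * suc (pred Q)         ≡⟨ cong (λ z → g + u * p * z) (suc-pred Q) ⟩
    g + u * p * Q                    ∎)
    where
    lemma : ∀ Q u p g → Q * u * p + (g + u * p) ≡ g + u * p * suc Q
    lemma = solve-∀

  -- Q * y ≥ y, so that the difference is not truncated.
  N₀ = Q * y + τ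

  y≤N₀ : y ≤ N₀
  y≤N₀ = ≤-trans (m≤n*m y Q) (m≤m+n (Q * y) τ)

  j₀ e e′ c w : ℕ
  j₀ = proj₁ ∃-inverse
  e  = proj₁ (proj₂ ∃-inverse)
  e′ = proj₁ (proj₂ (proj₂ ∃-inverse))
  -- The distance from `y` to `N₀` is rounded up to a multiple `g * c`, with excess `w < g`.
  c = proj₁ (∃-round-up (pred g) (N₀ ∸ y))
  w = proj₁ (proj₂ (∃-round-up (pred g) (N₀ ∸ y)))

  w<g : w < suc (pred g)
  w<g = proj₁ (proj₂ (proj₂ (∃-round-up (pred g) (N₀ ∸ y))))

  y+g*c : y + g * c ≡ Q * y + (τ + w)
  y+g*c = begin
    y + g * c                ≡⟨ cong (λ z → y + z * c) g⁺≡g ⟨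
    y + suc (pred g) * c     ≡⟨ cong (y +_) (proj₂ (proj₂ (proj₂ (∃-round-up (pred g) (N₀ ∸ y))))) ⟩
    y + (N₀ ∸ y + w)         ≡⟨ +-assoc y _ w ⟨
    y + (N₀ ∸ y) + w         ≡⟨ cong (_+ w) (m+[n∸m]≡n y≤N₀) ⟩
    Q * y + τ + w            ≡⟨ +-assoc (Q * y) τ w ⟩
    Q * y + (τ + w)          ∎

  -- `j₀ * c` jumps by `p` advance by `g * c` modulo `Q`; reducing their number modulo `Q` changes
  -- no residue and gives `j < Q`.
  j = (j₀ * c) % Q
  J = (j₀ * c) / Q

  balance : y + j * p + (J * p + e * c) * Q ≡ (τ + w) + (y + e′ * c) * Q
  balance = begin
    y + j * p + (J * p + e * c) * Q           ≡⟨ l₁ y j p J e c Q ⟩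
    y + ((j + J * Q) * p + e * c * Q)         ≡⟨ cong (λ z → y + (z * p + e * c * Q)) (sym (m≡m%n+[m/n]*n (j₀ * c) Q)) ⟩
    y + (j₀ * c * p + e * c * Q)              ≡⟨ l₂ y j₀ c p e Q ⟩
    y + c * (j₀ * p + e * Q)                  ≡⟨ cong (λ z → y + c * z) (proj₂ (proj₂ (proj₂ ∃-inverse))) ⟩
    y + c * (g + e′ * Q)                      ≡⟨ l₃ y c g e′ Q ⟩
    y + g * c + e′ * c * Q                    ≡⟨ cong (_+ e′ * c * Q) y+g*c ⟩
    Q * y + (τ + w) + e′ * c * Q              ≡⟨ l₄ Q y (τ + w) e′ c ⟩
    (τ + w) + (y + e′ * c) * Q                ∎
    where
    l₁ : ∀ y j p J e c Q → y + j * p + (J * p + e * c) * Q ≡ y + ((j + J * Q) * p + e * c * Q)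
    l₁ = solve-∀
    l₂ : ∀ y j c p e Q → y + (j * c * p + e * c * Q) ≡ y + c * (j * p + e * Q)
    l₂ = solve-∀
    l₃ : ∀ y c g e Q → y + c * (g + e * Q) ≡ y + g * c + e * c * Q
    l₃ = solve-∀
    l₄ : ∀ Q y t e c → Q * y + t + e * c * Q ≡ t + (y + e * c) * Q
    l₄ = solve-∀

  residue : (y + j * p) % Q ≡ τ + w
  residue = begin
    (y + j * p) % Q                                   ≡⟨ [m+kn]%n≡m%n (y + j * p) (J * p + e * c) Q ⟨
    (y + j * p + (J * p + e * c) * Q) % Q             ≡⟨ cong (_% Q) balance ⟩
    (τ + w + (y + e′ * c) * Q) % Q                    ≡⟨ [m+kn]%n≡m%n (τ + w) (y + e′ * c) Q ⟩
    (τ + w) % Q                                       ≡⟨ m<n⇒m%n≡m (<-≤-trans (+-monoʳ-< τ (<-≤-trans w<g (≤-trans (≤-reflexive g⁺≡g) g≤W))) τ+W≤Q) ⟩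
    τ + w                                             ∎

∃-valuation : ∀ {k} → 1 < k → ∀ p → 1 ≤ p → ∃₂ λ v p′ → p ≡ k ^ v * p′ × ¬ k ∣ p′
∃-valuation {k} 1<k p 1≤p = go p p ≤-refl 1≤p
  where
  go : ∀ bound p → p ≤ bound → 1 ≤ p → ∃₂ λ v p′ → p ≡ k ^ v * p′ × ¬ k ∣ p′
  go zero p p≤0 1≤p = contradiction (≤-trans 1≤p p≤0) λ ()
  go (suc bound) p p≤ 1≤p with k ∣? p
  ... | no k∤p = 0 , p , sym (+-identityʳ p) , k∤p
  ... | yes (divides zero refl) = contradiction 1≤p λ ()
  ... | yes (divides c@(suc _) refl) with go bound c (≤-pred (<-≤-trans (m<m*n c k 1<k) p≤)) (s≤s z≤n)
  ... | v , p′ , eq , k∤p′ = suc v , p′ , trans (cong (_* k) eq) (lemma (k ^ v) p′ k) , k∤p′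
    where
    lemma : ∀ a b k → a * b * k ≡ k * a * b
    lemma = solve-∀

-- Finite kernels as automata

funToFin-injective : ∀ {m n} (g h : Fin m → Fin n) → funToFin g ≡ funToFin h → ∀ i → g i ≡ h i
funToFin-injective g h eq i = trans (sym (Fin.finToFun-funToFin g i))
  (trans (cong (λ x → finToFun x i) eq) (Fin.finToFun-funToFin h i))

-- The states are the kernel classes, and base-k digits are read from the least significant one. The
-- output of a state is a whole sequence `rep i`, and transitions are correct almost everywhere
-- only.
record Automaton {Ω : Set a} (k : ℕ) (f : ℕ → Ω) : Set a where
  field
    d       : ℕ
    rep     : Fin d → ℕ → Ω
    start   : Fin d
    step    : Fin k → Fin d → Fin d
    f≈start : AE (λ n → f n ≡ rep start n)
    ≈step   : ∀ b i → AE (λ n → rep i (k * n + toℕ b) ≡ rep (step b i) n)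

module _ (finite : Finite Ω) where
  open Asymptotic finite

  ≃⇒AE : ∀ {f g} → f ≃ g → AE (λ n → f n ≡ g n)
  ≃⇒AE {f} {g} = AlmostAll⇒AE (λ n → finite⇒≟ finite (f n) (g n))

  -- The kernel is closed under taking sections: a digit `b` after `(α, r)` leads to the exponent
  -- `suc α` and the offset `k ^ α * toℕ b + r`.
  automaton : ∀ {k f} → AsymptoticallyAutomatic k f → Automaton k f
  automaton {k} {f} (d , rep , kernel , classify) = record
    { d       = d
    ; rep     = rep
    ; start   = proj₁ f-class
    ; step    = λ b i → proj₁ (section-class b i)
    ; f≈start = ≃⇒AE (proj₂ f-class)
    ; ≈step   = λ b i → ≃⇒AE (proj₂ (section-class b i))
    }
    where
    f-class : ∃ λ i → f ≃ rep i
    f-class = classify (0 , 0 , s≤s z≤n , λ n → cong f (sym (trans (+-identityʳ _) (+-identityʳ n))))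

    section-class : ∀ (b : Fin k) i → ∃ λ j → (λ n → rep i (k * n + toℕ b)) ≃ rep j
    section-class b i with kernel i
    ... | α , r , r<k^α , rep≡ = classify (suc α , k ^ α * toℕ b + r , bound , λ n →
        trans (rep≡ _) (cong f (lemma (k ^ α) k n (toℕ b) r)))
      where
      lemma : ∀ K k n b r → K * (k * n + b) + r ≡ k * K * n + (K * b + r)
      lemma = solve-∀
      bound : k ^ α * toℕ b + r < k ^ suc α
      bound = begin-strict
        k ^ α * toℕ b + r          <⟨ +-monoʳ-< (k ^ α * toℕ b) r<k^α ⟩
        k ^ α * toℕ b + k ^ α      ≡⟨ trans (+-comm _ (k ^ α)) (sym (*-suc (k ^ α) (toℕ b))) ⟩
        k ^ α * suc (toℕ b)        ≤⟨ *-monoʳ-≤ (k ^ α) (Fin.toℕ<n b) ⟩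
        k ^ α * k                  ≡⟨ *-comm (k ^ α) k ⟩
        k ^ suc α                  ∎
        where open ≤-Reasoning

B*n+r<B*N : ∀ B {n N r} → r < B → n < N → B * n + r < B * N
B*n+r<B*N B {n} {N} {r} r<B n<N = begin-strict
  B * n + r      <⟨ +-monoʳ-< (B * n) r<B ⟩
  B * n + B      ≡⟨ trans (+-comm (B * n) B) (sym (*-suc B n)) ⟩
  B * suc n      ≤⟨ *-monoʳ-≤ B n<N ⟩
  B * N          ∎
  where open ≤-Reasoning

-- Reachable states and sections

module AutomatonProperties {Ω : Set a} {k : ℕ} {f : ℕ → Ω} (1<k : 1 < k) (aut : Automaton k f) where
  open Automaton aut public

  instance
    k≢0 : NonZero k
    k≢0 = >-nonZero (<⇒≤ 1<k)

  -- Paths in the transition graph are decidable, so sets of reachable states can be encoded by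
  -- bits; `reach⇒section` and `section⇒reach` translate to equality almost everywhere.
  Reach : Fin d → ℕ → Fin d → Set
  Reach i zero    j = j ≡ i
  Reach i (suc γ) j = ∃ λ i′ → ∃ λ b → Reach i γ i′ × j ≡ step b i′

  reach? : ∀ i γ j → Dec (Reach i γ j)
  reach? i zero    j = j Fin.≟ i
  reach? i (suc γ) j = Fin.any? λ i′ → Fin.any? λ b → reach? i γ i′ ×-dec (j Fin.≟ step b i′)

  append : ∀ γ u {i i′ b} → AE (λ n → rep i (k ^ γ * n + u) ≡ rep i′ n) →
    AE (λ n → rep i (k ^ suc γ * n + (k ^ γ * toℕ b + u)) ≡ rep (step b i′) n)
  append γ u {i} {i′} {b} h = AE-map
    (λ n (e , e′) → trans (cong (rep i) (lemma k (k ^ γ) n (toℕ b) u)) (trans e e′))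
    (AE-zip (AE-dilate k (toℕ b) (Fin.toℕ<n b) h) (≈step b i′))
    where
    lemma : ∀ k K n b u → k * K * n + (K * b + u) ≡ K * (k * n + b) + u
    lemma = solve-∀

  reach⇒section : ∀ i γ {j} → Reach i γ j → ∃ λ u → u < k ^ γ × AE (λ n → rep i (k ^ γ * n + u) ≡ rep j n)
  reach⇒section i zero refl = 0 , s≤s z≤n , AE-universal λ n → cong (rep i) (trans (+-identityʳ _) (+-identityʳ n))
  reach⇒section i (suc γ) (i′ , b , reach , refl) with reach⇒section i γ reach
  ... | u , u< , h = k ^ γ * toℕ b + u ,
    <-≤-trans (B*n+r<B*N (k ^ γ) u< (Fin.toℕ<n b)) (≤-reflexive (*-comm (k ^ γ) k)) ,
    append γ u h

  section⇒reach : ∀ i γ u → u < k ^ γ → ∃ λ j → Reach i γ j × AE (λ n → rep i (k ^ γ * n + u) ≡ rep j n)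
  section⇒reach i zero zero _ = i , refl , AE-universal λ n → cong (rep i) (trans (+-identityʳ _) (+-identityʳ n))
  section⇒reach i zero (suc u) (s≤s ())
  section⇒reach i (suc γ) u u<
    with j , reach , h ← section⇒reach i γ (_%_ u (k ^ γ) {{m^n≢0 k γ}}) (m%n<n u (k ^ γ) {{m^n≢0 k γ}})
    = step b j , (j , b , reach , refl) ,
      AE-map (λ n → trans (cong (λ x → rep i (k ^ suc γ * n + x)) u≡)) (append γ (u % k ^ γ) h)
    where
    instance _ = m^n≢0 k γ
    u/<k : u / k ^ γ < k
    u/<k = m<n*o⇒m/o<n u<
    b : Fin k
    b = fromℕ< u/<k
    u≡ : u ≡ k ^ γ * toℕ b + u % k ^ γ
    u≡ = trans (m≡B*[m/B]+m%B (k ^ γ) u)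
      (cong (λ x → k ^ γ * x + u % k ^ γ) (sym (Fin.toℕ-fromℕ< u/<k)))

  -- One more step acts monotonically on the set of states reached so far.
  reach-shift : ∀ i {x y} → (∀ j → Reach i x j → Reach i y j) → ∀ n j → Reach i (n + x) j → Reach i (n + y) j
  reach-shift i sub zero    j r = sub j r
  reach-shift i sub (suc n) j (i′ , b , r , eq) = i′ , b , reach-shift i sub n i′ r , eq

  -- The set of states reachable in γ steps determines the next one, so the
  -- sequence of these sets is ultimately periodic.
  reach-small : ∀ i γ → ∃ λ γ′ → γ′ ≤ 2 ^ d × (∀ j → Reach i γ′ j → Reach i γ j)
  reach-small i γ with Fin.pigeonhole {2 ^ d} ≤-refl (λ x → funToFin (bits (toℕ x)))
    where
    bit : {A : Set} → Dec A → Fin 2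
    bit (yes _) = zero
    bit (no _)  = suc zero
    bits : ℕ → Fin d → Fin 2
    bits x j = bit (reach? i x j)
  ... | fx , fy , x<y , eq = descend γ γ ≤-refl
    where
    x = toℕ fx
    y = toℕ fy

    x⊆y : ∀ j → Reach i x j → Reach i y j
    x⊆y j r with reach? i x j | reach? i y j | funToFin-injective _ _ eq j
    ... | _     | yes r′ | _ = r′
    ... | no ¬r | no _   | _ = ⊥-elim (¬r r)
    ... | yes _ | no _   | ()

    descend : ∀ fuel γ → γ ≤ fuel → ∃ λ γ′ → γ′ ≤ 2 ^ d × (∀ j → Reach i γ′ j → Reach i γ j)
    descend fuel γ γ≤fuel with γ ≤? 2 ^ d
    ... | yes small = γ , small , λ j r → r
    descend zero γ γ≤0 | no big = ⊥-elim (big (≤-trans γ≤0 z≤n))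
    descend (suc fuel) γ γ≤fuel | no big
      with m≤n⇒∃[o]m+o≡n (≤-trans (≤-pred (Fin.toℕ<n fy)) (<⇒≤ (≰⇒> big)))
    -- `γ = y + o` is replaced by the smaller `o + x`, whose reachable set is contained in the old
    -- one.
    ... | o , refl with descend fuel (o + x) (≤-pred (<-≤-trans (<-≤-trans (+-monoʳ-< o x<y) (≤-reflexive (+-comm o y))) γ≤fuel))
    ... | γ′ , small , sub = γ′ , small , λ j r →
      subst (λ z → Reach i z j) (+-comm o y) (reach-shift i x⊆y o j (sub j r))

  -- There are `d ^ d` maps from states to states, and `k ^ α₀ > α₀` leaves room for one more
  -- residue than maps.
  α₀ : ℕ
  α₀ = d ^ d

  record CommonSection : Set a where
    field
      r₀ s    : ℕ
      1≤s     : 1 ≤ s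
      r₀+s<   : r₀ + s < k ^ α₀
      agree   : AE (λ y → ∀ i → rep i (k ^ α₀ * y + r₀) ≡ rep i (k ^ α₀ * y + (r₀ + s)))

  abstract
    -- A residue sends each state to the state of its section. Two of `d ^ d + 1` residues induce
    -- the same map, so their sections agree for all states at once.
    commonSection : CommonSection
    commonSection with Fin.pigeonhole {d ^ d} ≤-refl (λ r → funToFin (λ i → proj₁ (class r i)))
      where
      class : ∀ (r : Fin (suc (d ^ d))) i →
        ∃ λ j → Reach i α₀ j × AE (λ n → rep i (k ^ α₀ * n + toℕ r) ≡ rep j n)
      class r i = section⇒reach i α₀ (toℕ r) (<-≤-trans (Fin.toℕ<n r) (m<l^m 1<k α₀))
    ... | fr , fr′ , r<r′ , eq with m≤n⇒∃[o]m+o≡n r<r′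
    ... | o , r+o≡r′ = record
      { r₀ = toℕ fr
      ; s = suc o
      ; 1≤s = s≤s z≤n
      ; r₀+s< = subst (_< k ^ α₀) r′≡ (<-≤-trans (Fin.toℕ<n fr′) (m<l^m 1<k α₀))
      ; agree = AE-∀Fin λ i → AE-map
          (λ y (e , e′) → trans e (trans (cong (λ j → rep j y) (funToFin-injective _ _ eq i))
            (trans (sym e′) (cong (λ z → rep i (k ^ α₀ * y + z)) r′≡))))
          (AE-zip (proj₂ (proj₂ (section⇒reach i α₀ (toℕ fr) _))) (proj₂ (proj₂ (section⇒reach i α₀ (toℕ fr′) _))))
      }
      where
      r′≡ : toℕ fr′ ≡ toℕ fr + suc o
      r′≡ = trans (sym r+o≡r′) (sym (+-suc (toℕ fr) o))

  open CommonSection commonSection public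

  -- After the `c` low digits `w`, state `i` has become some `j`, and `agree` for `j` on the higher
  -- digits gives the shift `k ^ c * s`.
  agree-at-scale : ∀ c → AE (λ x → ∀ n w → w < k ^ c → x ≡ k ^ (c + α₀) * n + (k ^ c * r₀ + w) →
    ∀ i → rep i x ≡ rep i (x + k ^ c * s))
  agree-at-scale c = AE-map unpack (AE-/ Q (AE-∀< (k ^ c) λ w w< → AE-∀Fin λ i → fine i w w<))
    where
    Q = k ^ (c + α₀)
    instance
      Q≢0 : NonZero (k ^ (c + α₀))
      Q≢0 = m^n≢0 k (c + α₀)

    r₀< : r₀ < k ^ α₀
    r₀< = ≤-<-trans (m≤m+n r₀ s) r₀+s<

    fine : ∀ i w → w < k ^ c → AE (λ y →
      rep i (k ^ c * (k ^ α₀ * y + r₀) + w) ≡ rep i (k ^ c * (k ^ α₀ * y + (r₀ + s)) + w))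
    fine i w w< with j , _ , h ← section⇒reach i c w w< = AE-map
      (λ y ((e , e′) , top) → trans e (trans (top j) (sym e′)))
      (AE-zip (AE-zip (AE-dilate (k ^ α₀) r₀ r₀< h) (AE-dilate (k ^ α₀) (r₀ + s) r₀+s< h)) agree)

    lemma : ∀ C K n r w → C * (K * n + r) + w ≡ C * K * n + (C * r + w)
    lemma = solve-∀

    lemma′ : ∀ C K n r s w → C * (K * n + (r + s)) + w ≡ C * (K * n + r) + w + C * s
    lemma′ = solve-∀

    unpack : ∀ x →
      (∀ w → w < k ^ c → ∀ i →
        rep i (k ^ c * (k ^ α₀ * (x / Q) + r₀) + w) ≡ rep i (k ^ c * (k ^ α₀ * (x / Q) + (r₀ + s)) + w)) →
      ∀ n w → w < k ^ c → x ≡ Q * n + (k ^ c * r₀ + w) → ∀ i → rep i x ≡ rep i (x + k ^ c * s)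
    unpack x eq n w w< x≡ i = begin
      rep i x                                              ≡⟨ cong (rep i) x≡′ ⟩
      rep i (k ^ c * (k ^ α₀ * (x / Q) + r₀) + w)          ≡⟨ eq w w< i ⟩
      rep i (k ^ c * (k ^ α₀ * (x / Q) + (r₀ + s)) + w)    ≡⟨ cong (rep i) (trans (lemma′ (k ^ c) (k ^ α₀) (x / Q) r₀ s w) (cong (_+ k ^ c * s) (sym x≡′))) ⟩
      rep i (x + k ^ c * s)                                ∎
      where
      open ≡-Reasoning
      Q≡ : Q ≡ k ^ c * k ^ α₀
      Q≡ = ^-distribˡ-+-* k c α₀
      x/Q≡n : x / Q ≡ n
      x/Q≡n = trans (cong (_/ Q) x≡) ([B*n+r]/B≡n Q n (<-≤-trans (B*n+r<B*N (k ^ c) w< r₀<) (≤-reflexive (sym Q≡))))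
      x≡′ : x ≡ k ^ c * (k ^ α₀ * (x / Q) + r₀) + w
      x≡′ = trans x≡ (trans (cong₂ (λ A m → A * m + (k ^ c * r₀ + w)) Q≡ (sym x/Q≡n))
        (sym (lemma (k ^ c) (k ^ α₀) (x / Q) r₀ w)))

-- From local periods to a global one

PeriodicOnWindow : {Ω : Set a} → (ℕ → Ω) → ℕ → ℕ → ℕ → Set a
PeriodicOnWindow f K p n = ∀ r → r + p < K → f (K * n + r) ≡ f (K * n + (r + p))

periodic-multiple : ∀ {Ω : Set a} (f : ℕ → Ω) K p n → PeriodicOnWindow f K p n →
  ∀ j → PeriodicOnWindow f K (j * p) n
periodic-multiple f K p n per zero    r _  = cong (λ x → f (K * n + x)) (sym (+-identityʳ r))
periodic-multiple f K p n per (suc j) r lt = trans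
  (periodic-multiple f K p n per j r (≤-<-trans (+-monoʳ-≤ r (m≤n+m (j * p) p)) lt))
  (trans (per (r + j * p) (subst (_< K) (sym eq) lt)) (cong (λ x → f (K * n + x)) eq))
  where
  eq : r + j * p + p ≡ r + (p + j * p)
  eq = trans (+-assoc r (j * p) p) (cong (r +_) (+-comm (j * p) p))

sum-edge≤ : ∀ B e → sum B (λ t → 𝟙 (¬? (t + e ≤? B))) ≤ e
sum-edge≤ B e with e ≤? B
... | no e≰B = ≤-trans (sum-mono-≤ B λ t _ → 𝟙≤1 (¬? (t + e ≤? B)))
  (≤-trans (≤-reflexive (trans (sum-const B 1) (*-identityʳ B))) (<⇒≤ (≰⇒> e≰B)))
... | yes e≤B = begin
  sum B g                                              ≡⟨ cong (λ x → sum x g) (sym B≡) ⟩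
  sum (B ∸ e + e) g                                    ≡⟨ sum-split (B ∸ e) e g ⟩
  sum (B ∸ e) g + sum e (λ t → g (B ∸ e + t))          ≤⟨ +-mono-≤ (≤-reflexive inner) outer ⟩
  0 + e                                                ≡⟨⟩
  e                                                    ∎
  where
  open ≤-Reasoning
  g : ℕ → ℕ
  g t = 𝟙 (¬? (t + e ≤? B))
  B≡ : B ∸ e + e ≡ B
  B≡ = m∸n+n≡m e≤B
  inner : sum (B ∸ e) g ≡ 0
  inner = trans (sum-cong (B ∸ e) λ t t< → 𝟙-¬ (¬? (t + e ≤? B)) λ ¬le →
    ¬le (≤-trans (+-monoˡ-≤ e (<⇒≤ t<)) (≤-reflexive B≡)))
    (trans (sum-const (B ∸ e) 0) (*-zeroʳ (B ∸ e)))
  outer : sum e (λ t → g (B ∸ e + t)) ≤ e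
  outer = ≤-trans (sum-mono-≤ e λ t _ → 𝟙≤1 (¬? (B ∸ e + t + e ≤? B)))
    (≤-reflexive (trans (sum-const e 1) (*-identityʳ e)))

Most-interior : ∀ M B e .{{_ : NonZero B}} → 2 * M * e ≤ B → Most M (λ y → y % B + e ≤ B)
Most-interior M B e le = E , Small-blocks B M e E block le , λ n eq →
  decidable-stable (n % B + e ≤? B) (𝟙≡0⇒¬ (¬? (n % B + e ≤? B)) eq)
  where
  E : ℕ → ℕ
  E y = 𝟙 (¬? (y % B + e ≤? B))
  block : ∀ x → sum B (λ t → E (B * x + t)) ≤ e
  block x = ≤-trans (≤-reflexive (sum-cong B λ t t<B →
    cong (λ z → 𝟙 (¬? (z + e ≤? B))) ([B*n+r]%B≡r B x t<B))) (sum-edge≤ B e)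

-- From short periods on windows to a fixed shift

module _ {Ω : Set a} {k : ℕ} {f : ℕ → Ω} (1<k : 1 < k) (aut : Automaton k f) where
  open AutomatonProperties 1<k aut

  f-section : ∀ γ u → u < k ^ γ → ∃ λ j → Reach start γ j × AE (λ n → f (k ^ γ * n + u) ≡ rep j n)
  f-section γ u u< with j , reach , h ← section⇒reach start γ u u< =
    j , reach , AE-map (λ n (e , e′) → trans e e′) (AE-zip (AE-dilate (k ^ γ) u u< f≈start) h)

  reach⇒f-section : ∀ γ {j} → Reach start γ j → ∃ λ u → u < k ^ γ × AE (λ n → f (k ^ γ * n + u) ≡ rep j n)
  reach⇒f-section γ r with u , u< , h ← reach⇒section start γ r =
    u , u< , AE-map (λ n (e , e′) → trans e e′) (AE-zip (AE-dilate (k ^ γ) u u< f≈start) h)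

  -- With `c = a₀ + (U ∸ v′)` the product `k ^ v′ * (k ^ c * s)` is `shift` for every `v′ ≤ U`, and
  -- `jumps` bounds the modulus `k ^ (c + α₀)`.
  U a₀ shift jumps : ℕ
  U     = 2 ^ d
  a₀    = k * α₀
  shift = k ^ (U + a₀) * s
  jumps = k ^ (U + a₀ + α₀)

  -- a₀ is large enough for k^α₀ ≤ 2^a₀.
  gcd-bound : ∀ {p′} → ¬ k ∣ p′ → ∀ c → a₀ ≤ c → gcd p′ (k ^ (c + α₀)) ≤ k ^ c
  gcd-bound {p′} k∤p′ c a₀≤c = *-cancelʳ-≤ _ _ (k ^ α₀) {{m^n≢0 k α₀}} (begin
    gcd p′ (k ^ (c + α₀)) * k ^ α₀           ≤⟨ *-monoʳ-≤ (gcd p′ (k ^ (c + α₀))) k^α₀≤ ⟩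
    gcd p′ (k ^ (c + α₀)) * 2 ^ (c + α₀)     ≤⟨ gcd[p,k^A]*2^A≤k^A k∤p′ (c + α₀) ⟩
    k ^ (c + α₀)                             ≡⟨ ^-distribˡ-+-* k c α₀ ⟩
    k ^ c * k ^ α₀                           ∎)
    where
    open ≤-Reasoning
    k^α₀≤ : k ^ α₀ ≤ 2 ^ (c + α₀)
    k^α₀≤ = begin
      k ^ α₀             ≤⟨ ^-monoˡ-≤ α₀ (<⇒≤ (m<l^m (s≤s (s≤s z≤n)) k)) ⟩
      (2 ^ k) ^ α₀       ≡⟨ ^-*-assoc 2 k α₀ ⟩
      2 ^ (k * α₀)       ≤⟨ ^-monoʳ-≤ 2 (≤-trans a₀≤c (m≤m+n c α₀)) ⟩
      2 ^ (c + α₀)       ∎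

  -- Five doublings: two pullbacks along division and three intersections.
  32× : ℕ → ℕ
  32× M = 2 * (2 * (2 * (2 * (2 * M))))

  module Transfer (M α p v p′ v′ : ℕ) (1≤p : 1 ≤ p)
    (C*p≤k^α : suc (32× M * (jumps + shift)) * p ≤ k ^ α)
    (most-periodic : Most (32× M) (PeriodicOnWindow f (k ^ α) p))
    (p≡ : p ≡ k ^ v * p′) (k∤p′ : ¬ k ∣ p′)
    (v′≤U : v′ ≤ U) (v′⊆v : ∀ j → Reach start v′ j → Reach start v j) where

    -- After `v` digits a window of length `K` with period `p` becomes one of length `B` with period
    -- `p′`. The margin `e` allows for fewer than `Q` jumps by `p′` and one shift by `δ`.
    M₁ M₂ c e Q B K δ : ℕ
    M₁ = 2 * (2 * M)
    M₂ = 2 * (2 * M₁)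
    K = k ^ α
    c = a₀ + (U ∸ v′)
    δ = k ^ c * s
    Q = k ^ (c + α₀)
    e = Q * p′ + δ
    B = k ^ (α ∸ v)

    instance
      B≢0 : NonZero (k ^ (α ∸ v))
      B≢0 = m^n≢0 k (α ∸ v)
      k^v≢0 : NonZero (k ^ v)
      k^v≢0 = m^n≢0 k v
      k^v′≢0 : NonZero (k ^ v′)
      k^v′≢0 = m^n≢0 k v′
      Q≢0 : NonZero (k ^ (c + α₀))
      Q≢0 = m^n≢0 k (c + α₀)

    v′+c≡ : v′ + c ≡ U + a₀
    v′+c≡ = begin
      v′ + (a₀ + (U ∸ v′))   ≡⟨ cong (v′ +_) (+-comm a₀ (U ∸ v′)) ⟩
      v′ + (U ∸ v′ + a₀)     ≡⟨ +-assoc v′ _ a₀ ⟨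
      v′ + (U ∸ v′) + a₀     ≡⟨ cong (_+ a₀) (m+[n∸m]≡n v′≤U) ⟩
      U + a₀                 ∎
      where open ≡-Reasoning

    k^v′*δ≡shift : k ^ v′ * δ ≡ shift
    k^v′*δ≡shift = trans (sym (*-assoc (k ^ v′) (k ^ c) s))
      (cong (_* s) (trans (sym (^-distribˡ-+-* k v′ c)) (cong (k ^_) v′+c≡)))

    1≤p′ : 1 ≤ p′
    1≤p′ = n≢0⇒n>0 λ { refl → contradiction (≤-trans 1≤p (≤-reflexive (trans p≡ (*-zeroʳ (k ^ v))))) λ () }

    k^v≤p : k ^ v ≤ p
    k^v≤p = ≤-trans (m≤m*n (k ^ v) p′ {{>-nonZero 1≤p′}}) (≤-reflexive (sym p≡))

    v≤α : v ≤ α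
    v≤α = ≮⇒≥ λ α<v → <-irrefl refl (begin-strict
      k ^ α     <⟨ ^-monoʳ-< k 1<k α<v ⟩
      k ^ v     ≤⟨ k^v≤p ⟩
      -- The `suc` in the constant leaves a summand `p`, also for `M` = 0.
      p         ≤⟨ m+n≤o⇒m≤o p C*p≤k^α ⟩
      k ^ α     ∎)
      where open ≤-Reasoning

    K≡ : K ≡ k ^ v * B
    K≡ = trans (cong (k ^_) (sym (m+[n∸m]≡n v≤α))) (^-distribˡ-+-* k v (α ∸ v))

    -- Multiplied by `k ^ v`, the margin is at most `(jumps + shift) * p`, because `k ^ v * p′` is
    -- `p` and `k ^ v ≤ p`.
    edge-small : 2 * M₂ * e ≤ B
    edge-small = *-cancelˡ-≤ (k ^ v) (begin
      k ^ v * (2 * M₂ * (Q * p′ + δ))                 ≡⟨ lemma (k ^ v) (2 * M₂) Q p′ δ ⟩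
      2 * M₂ * (Q * (k ^ v * p′) + k ^ v * δ)         ≤⟨ *-monoʳ-≤ (2 * M₂) (+-mono-≤ (*-mono-≤ Q≤jumps (≤-reflexive (sym p≡))) (≤-trans (*-monoʳ-≤ (k ^ v) δ≤shift) (≤-trans (*-monoˡ-≤ shift k^v≤p) (≤-reflexive (*-comm p shift))))) ⟩
      2 * M₂ * (jumps * p + shift * p)                ≡⟨ lemma′ (2 * M₂) jumps shift p ⟩
      2 * M₂ * (jumps + shift) * p                    ≤⟨ m+n≤o⇒n≤o p C*p≤k^α ⟩
      k ^ α                                           ≡⟨ K≡ ⟩
      k ^ v * B                                       ∎)
      where
      open ≤-Reasoning
      lemma : ∀ v m q p d → v * (m * (q * p + d)) ≡ m * (q * (v * p) + v * d)
      lemma = solve-∀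
      lemma′ : ∀ m j s p → m * (j * p + s * p) ≡ m * (j + s) * p
      lemma′ = solve-∀
      c≤U+a₀ : c ≤ U + a₀
      c≤U+a₀ = ≤-trans (m≤n+m c v′) (≤-reflexive v′+c≡)
      Q≤jumps : Q ≤ jumps
      Q≤jumps = ^-monoʳ-≤ k (+-monoˡ-≤ α₀ c≤U+a₀)
      δ≤shift : δ ≤ shift
      δ≤shift = *-monoˡ-≤ s (^-monoʳ-≤ k c≤U+a₀)

    -- The offset `u` is chosen before `t`, since `via` compares values of `f` at several `t` within
    -- one section.
    Clean : ℕ → Set _
    Clean x = (∀ i → Reach start v i → ∃ λ u → u < k ^ v × (∀ t → t < suc e → f (k ^ v * (x + t) + u) ≡ rep i (x + t))) ×
      (∀ t → t < suc e → ∀ n w → w < k ^ c → x + t ≡ Q * n + (k ^ c * r₀ + w) → ∀ i → rep i (x + t) ≡ rep i (x + t + δ))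

    clean : AE Clean
    clean = AE-zip
      (AE-∀Fin λ i → AE-dec→ (reach? start v i) λ r → let u , u< , h = reach⇒f-section v r in
        AE-map (λ x eq → u , u< , eq) (AE-∀< (suc e) λ t _ → AE-shift t h))
      (AE-∀< (suc e) λ t _ → AE-shift t (agree-at-scale c))

    window≤Q : k ^ c * r₀ + k ^ c ≤ Q
    window≤Q = ≤-trans (≤-reflexive (trans (+-comm _ (k ^ c)) (sym (*-suc (k ^ c) r₀))))
      (≤-trans (*-monoʳ-≤ (k ^ c) (≤-<-trans (m≤m+n r₀ s) r₀+s<)) (≤-reflexive (sym (^-distribˡ-+-* k c α₀))))

    -- y is moved by a multiple of p′ to a place where all states have
    -- the period δ, and back again.
    via : ∀ y → PeriodicOnWindow f K p (y / B) → y % B + e ≤ B → ∀ i u → u < k ^ v →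
      (∀ t → t < suc e → f (k ^ v * (y + t) + u) ≡ rep i (y + t)) → ∀ j → j < Q →
      (j * p′ < suc e → rep i (y + j * p′) ≡ rep i (y + j * p′ + δ)) →
      rep i y ≡ rep i (y + δ)
    via y per interior i u u< f≡rep j j<Q at-rep
      = begin
      rep i y                      ≡⟨ cong (rep i) (+-identityʳ y) ⟨
      rep i (y + 0)                ≡⟨ hop 0 (≤-<-trans (m≤m+n (j * p′) δ) jp′+δ<e) ⟩
      rep i (y + j * p′)           ≡⟨ at-rep (s≤s (≤-trans (m≤m+n _ δ) (<⇒≤ jp′+δ<e))) ⟩
      rep i (y + j * p′ + δ)       ≡⟨ cong (rep i) (trans (+-assoc y _ δ) (cong (y +_) (+-comm (j * p′) δ))) ⟩
      rep i (y + (δ + j * p′))     ≡⟨ hop δ (subst (_< e) (+-comm (j * p′) δ) jp′+δ<e) ⟨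
      rep i (y + δ)                ∎
      where
      open ≡-Reasoning
      jp′+δ<e : j * p′ + δ < e
      jp′+δ<e = +-monoˡ-< δ (*-monoˡ-< p′ {{>-nonZero 1≤p′}} j<Q)

      position : ∀ t → k ^ v * (y + t) + u ≡ K * (y / B) + (k ^ v * (y % B + t) + u)
      position t = begin
        k ^ v * (y + t) + u                                  ≡⟨ cong (λ z → k ^ v * (z + t) + u) (m≡B*[m/B]+m%B B y) ⟩
        k ^ v * (B * (y / B) + y % B + t) + u                ≡⟨ lemma (k ^ v) B (y / B) (y % B) t u ⟩
        k ^ v * B * (y / B) + (k ^ v * (y % B + t) + u)      ≡⟨ cong (λ z → z * (y / B) + (k ^ v * (y % B + t) + u)) K≡ ⟨
        K * (y / B) + (k ^ v * (y % B + t) + u)              ∎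
        where
        lemma : ∀ V B n r t u → V * (B * n + r + t) + u ≡ V * B * n + (V * (r + t) + u)
        lemma = solve-∀

      jump : ∀ t → k ^ v * (y % B + (t + j * p′)) + u ≡ k ^ v * (y % B + t) + u + j * p
      jump t = trans (lemma (k ^ v) (y % B) t j p′ u) (cong (λ z → k ^ v * (y % B + t) + u + j * z) (sym p≡))
        where
        lemma : ∀ V r t j p u → V * (r + (t + j * p)) + u ≡ V * (r + t) + u + j * (V * p)
        lemma = solve-∀

      -- A move by `j * p′` of the argument of `rep i` is a move by `j * p` of the argument of `f`;
      -- the interior condition keeps it inside the window.
      hop : ∀ t → t + j * p′ < e → rep i (y + t) ≡ rep i (y + (t + j * p′))
      hop t t+jp′<e = begin
        rep i (y + t)                                                   ≡⟨ f≡rep t (s≤s (≤-trans (m≤m+n t _) (<⇒≤ t+jp′<e))) ⟨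
        f (k ^ v * (y + t) + u)                                         ≡⟨ cong f (position t) ⟩
        f (K * (y / B) + (k ^ v * (y % B + t) + u))                     ≡⟨ periodic-multiple f K p (y / B) per j _ inside ⟩
        f (K * (y / B) + (k ^ v * (y % B + t) + u + j * p))             ≡⟨ cong (λ z → f (K * (y / B) + z)) (jump t) ⟨
        f (K * (y / B) + (k ^ v * (y % B + (t + j * p′)) + u))          ≡⟨ cong f (position (t + j * p′)) ⟨
        f (k ^ v * (y + (t + j * p′)) + u)                              ≡⟨ f≡rep (t + j * p′) (s≤s (<⇒≤ t+jp′<e)) ⟩
        rep i (y + (t + j * p′))                                        ∎
        where
        inside : k ^ v * (y % B + t) + u + j * p < K
        inside = subst₂ _<_ (jump t) (sym K≡)
          (B*n+r<B*N (k ^ v) u< (<-≤-trans (+-monoʳ-< (y % B) t+jp′<e) interior))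

    -- The good places are `k ^ c` consecutive residues modulo `Q`. As `gcd p′ Q ≤ k ^ c`, a
    -- multiple of `p′` leads into them from any `y`.
    transfer : ∀ y → (PeriodicOnWindow f K p (y / B) × y % B + e ≤ B) × Clean y →
      ∀ i → Reach start v i → rep i y ≡ rep i (y + δ)
    transfer y ((per , interior) , at-f , at-rep) i reach =
      let u , u< , f≡rep = at-f i reach
          j , n , w , j<Q , w< , y+jp′≡ = ∃-multiple-in-interval {p′} {Q} (k ^ c)
            (gcd-bound k∤p′ c (m≤m+n a₀ (U ∸ v′))) (k ^ c * r₀) window≤Q y
      in via y per interior i u u< f≡rep j j<Q (λ lt → at-rep (j * p′) lt n w w< y+jp′≡ i)

    rep-invariant : Most M₁ (λ y → ∀ i → Reach start v i → rep i y ≡ rep i (y + δ))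
    rep-invariant = Most-map M₁ transfer (Most-zip M₁
      (Most-zip (2 * M₁) (Most-/ B M₂ most-periodic) (Most-interior M₂ B e edge-small))
      (clean (2 * M₁)))

    sections : AE (λ y → ∀ u → u < k ^ v′ →
      ∃ λ j → Reach start v′ j × f (k ^ v′ * y + u) ≡ rep j y × f (k ^ v′ * (y + δ) + u) ≡ rep j (y + δ))
    sections = AE-∀< (k ^ v′) λ u u< → let j , r , h = f-section v′ u u< in
      AE-map (λ y (e , e′) → j , r , e , e′) (AE-zip h (AE-shift δ h))

    -- `f` is read through `v′` digits instead of `v`: `k ^ v′ * δ` is the fixed `shift`, whereas
    -- `k ^ v * δ` depends on the local period.
    finish : ∀ m →
      (∀ i → Reach start v i → rep i (m / k ^ v′) ≡ rep i (m / k ^ v′ + δ)) ×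
      (∀ u → u < k ^ v′ → ∃ λ j → Reach start v′ j × f (k ^ v′ * (m / k ^ v′) + u) ≡ rep j (m / k ^ v′) ×
        f (k ^ v′ * (m / k ^ v′ + δ) + u) ≡ rep j (m / k ^ v′ + δ)) →
      f (m + shift) ≡ f m
    finish m (inv , secs) with j , reach , eq , eq′ ← secs (m % k ^ v′) (m%n<n m (k ^ v′)) = begin
      f (m + shift)                                ≡⟨ cong f m+shift≡ ⟩
      f (k ^ v′ * (m / k ^ v′ + δ) + m % k ^ v′)   ≡⟨ eq′ ⟩
      rep j (m / k ^ v′ + δ)                       ≡⟨ inv j (v′⊆v j reach) ⟨
      rep j (m / k ^ v′)                           ≡⟨ eq ⟨
      f (k ^ v′ * (m / k ^ v′) + m % k ^ v′)       ≡⟨ cong f (m≡B*[m/B]+m%B (k ^ v′) m) ⟨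
      f m                                          ∎
      where
      open ≡-Reasoning
      lemma : ∀ V y δ u → V * y + u + V * δ ≡ V * (y + δ) + u
      lemma = solve-∀
      m+shift≡ : m + shift ≡ k ^ v′ * (m / k ^ v′ + δ) + m % k ^ v′
      m+shift≡ = trans (cong₂ _+_ (m≡B*[m/B]+m%B (k ^ v′) m) (sym k^v′*δ≡shift))
        (lemma (k ^ v′) (m / k ^ v′) δ (m % k ^ v′))

    most-shift-invariant : Most M (λ m → f (m + shift) ≡ f m)
    most-shift-invariant = Most-map M finish
      (Most-/ (k ^ v′) M (Most-zip (2 * M) rep-invariant (sections (2 * (2 * M)))))

  shift-invariant :
    (∀ M C → ∃₂ λ α p → 1 ≤ p × C * p ≤ k ^ α × Most M (PeriodicOnWindow f (k ^ α) p)) →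
    ∃ λ q → 1 ≤ q × AE (λ m → f (m + q) ≡ f m)
  -- The witness is fixed before `M`; only the local period and the data derived from it vary with
  -- `M`.
  shift-invariant local = shift , *-mono-≤ (m^n>0 k (U + a₀)) 1≤s , λ M →
    let α , p , 1≤p , C*p≤k^α , most-periodic = local (32× M) (suc (32× M * (jumps + shift)))
        v , p′ , p≡ , k∤p′                    = ∃-valuation 1<k p 1≤p
        v′ , v′≤U , v′⊆v                      = reach-small start v
    in Transfer.most-shift-invariant M α p v p′ v′ 1≤p C*p≤k^α most-periodic p≡ k∤p′ v′≤U v′⊆v

-- Local periods

n∣N! : ∀ {n N} → 1 ≤ n → n ≤ N → n ∣ N !
n∣N! {suc n} _ n≤N = ∣-trans (m∣m*n (n !)) (m≤n⇒m!∣n! n≤N)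

Most-repeats : ∀ M D H .{{_ : NonZero H}} (code : ℕ → ℕ → ℕ) → (∀ x t → code x t < D) → 2 * M * D ≤ H →
  Most M (λ n → Repeats (code (n / H)) (n % H))
Most-repeats M D H code code<D le = E , Small-blocks H M D E block le , λ n eq →
  decidable-stable (repeats? (code (n / H)) (n % H)) (𝟙≡0⇒¬ (¬? (repeats? (code (n / H)) (n % H))) eq)
  where
  E : ℕ → ℕ
  E n = fresh (code (n / H)) (n % H)
  block : ∀ x → sum H (λ t → E (H * x + t)) ≤ D
  block x = ≤-trans (≤-reflexive (sum-cong H λ t t<H →
      cong₂ (λ y u → fresh (code y) u) ([B*n+r]/B≡n H x t<H) ([B*n+r]%B≡r H x t<H)))
    (sum-fresh≤ D (code x) H (code<D x))

-- Within `t ≤ H` steps the multiples of `K` and `L` drift apart by `δ * t ≤ K`.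
distance-bounds : ∀ {K L δ} → Distance K L δ → ∀ {H t} → H * δ ≤ K → t ≤ H →
  K * t ≤ L * t + K × L * t ≤ K * t + K
distance-bounds {K} {L} {δ} dist {H} {t} Hδ≤K t≤H = bounds dist
  where
  δ*t≤K : δ * t ≤ K
  δ*t≤K = ≤-trans (≤-trans (*-monoʳ-≤ δ t≤H) (≤-reflexive (*-comm δ H))) Hδ≤K
  bounds : Distance K L δ → K * t ≤ L * t + K × L * t ≤ K * t + K
  bounds (inj₁ K≡) =
    ≤-trans (≤-reflexive (trans (cong (_* t) K≡) (*-distribʳ-+ t L δ))) (+-monoʳ-≤ (L * t) δ*t≤K) ,
    ≤-trans (*-monoˡ-≤ t (≤-trans (m≤m+n L δ) (≤-reflexive (sym K≡)))) (m≤m+n (K * t) K)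
  bounds (inj₂ L≡) =
    ≤-trans (*-monoˡ-≤ t (≤-trans (m≤m+n K δ) (≤-reflexive (sym L≡)))) (m≤m+n (L * t) K) ,
    ≤-trans (≤-reflexive (trans (cong (_* t) L≡) (*-distribʳ-+ t K δ))) (+-monoʳ-≤ (K * t) δ*t≤K)

distance⇒K≤2L : ∀ {K L δ} → Distance K L δ → 2 * δ ≤ K → K ≤ 2 * L
distance⇒K≤2L {K} {L} {δ} (inj₁ refl) 2δ≤K = +-monoʳ-≤ L (≤-trans (+-cancelʳ-≤ δ δ L
  (≤-trans (≤-reflexive (cong (δ +_) (sym (+-identityʳ δ)))) 2δ≤K)) (≤-reflexive (sym (+-identityʳ L))))
distance⇒K≤2L {K} {L} {δ} (inj₂ refl) _ = ≤-trans (m≤m+n K δ) (m≤m+n (K + δ) _)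

-- Comparison of windows of two nearby lengths

module Windows {Ω : Set a} {m : ℕ} (enc : Ω → Fin m) (enc-injective : ∀ {x y} → enc x ≡ enc y → x ≡ y)
  {k l : ℕ} {f : ℕ → Ω} (1<k : 1 < k) (1<l : 1 < l) (autₖ : Automaton k f) (autₗ : Automaton l f)
  (α β δ H : ℕ) (dist : Distance (k ^ α) (l ^ β) δ) (Hδ≤K : H * δ ≤ k ^ α) (2δ≤K : 2 * δ ≤ k ^ α)
  where

  module A = Automaton autₖ
  module B = Automaton autₗ

  K L : ℕ
  K = k ^ α
  L = l ^ β

  instance
    L≢0 : NonZero (l ^ β)
    L≢0 = m^n≢0 l β {{>-nonZero (<⇒≤ 1<l)}}

  stateₖ : Fin K → Fin A.d
  stateₖ r = proj₁ (f-section 1<k autₖ α (toℕ r) (Fin.toℕ<n r))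

  stateₗ : Fin L → Fin B.d
  stateₗ r = proj₁ (f-section 1<l autₗ β (toℕ r) (Fin.toℕ<n r))

  Cleanₖ Cleanₗ : ℕ → Set _
  Cleanₖ n = ∀ r → f (K * n + toℕ r) ≡ A.rep (stateₖ r) n
  Cleanₗ z = ∀ r → f (L * z + toℕ r) ≡ B.rep (stateₗ r) z

  cleanₖ : AE Cleanₖ
  cleanₖ = AE-∀Fin λ r → proj₂ (proj₂ (f-section 1<k autₖ α (toℕ r) (Fin.toℕ<n r)))

  cleanₗ : AE Cleanₗ
  cleanₗ = AE-∀Fin λ r → proj₂ (proj₂ (f-section 1<l autₗ β (toℕ r) (Fin.toℕ<n r)))

  -- The index of the window of length `L` that contains the start of the `x`-th group of `H`
  -- windows of length `K`.
  Z : ℕ → ℕ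
  Z x = K * (H * x) / L

  -- The windows of length K are indexed from 2 so that the one with index
  -- H x + t + 2 lies to the right of L (Z x + t) in spite of the drift between
  -- multiples of K and of L; nine windows of length L then cover it.
  code : ℕ → ℕ → Fin (m ^ A.d * (m ^ B.d) ^ 9)
  code x t = combine
    (funToFin λ i → enc (A.rep i (H * x + t + 2)))
    (funToFin λ j → funToFin λ i → enc (B.rep i (Z x + t + toℕ {9} j)))

  code-≡ : ∀ x {t u} → code x t ≡ code x u →
    (∀ i → A.rep i (H * x + t + 2) ≡ A.rep i (H * x + u + 2)) ×
    (∀ (j : Fin 9) i → B.rep i (Z x + t + toℕ j) ≡ B.rep i (Z x + u + toℕ j))
  code-≡ x {t} {u} eq =
    let eqₖ , eqₗ = Fin.combine-injective _ _ _ _ eq in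
    (λ i → enc-injective (funToFin-injective _ _ eqₖ i)) ,
    (λ j i → enc-injective (funToFin-injective _ _
      (funToFin-injective (λ j → funToFin λ i → enc (B.rep i (Z x + t + toℕ j)))
        (λ j → funToFin λ i → enc (B.rep i (Z x + u + toℕ j))) eqₗ j) i))

  CleanBlock : ℕ → Set _
  CleanBlock x = (∀ t → t < H → Cleanₖ (H * x + t + 2)) × (∀ c → c < H + 9 → Cleanₗ (Z x + c))

  cleanBlock : 1 ≤ H → AE CleanBlock
  cleanBlock 1≤H = AE-zip
    (AE-∀< H λ t t<H → AE-dilate H t t<H (AE-shift 2 cleanₖ))
    -- `Z x + c` is `(K * H * x + L * c) / L`, so the null set is pulled back along a division, a
    -- shift and a dilation in turn.
    (AE-∀< (H + 9) λ c _ → AE-map (λ x → subst Cleanₗ (index x c))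
      (AE-dilate (K * H) 0 (*-mono-≤ (m^n>0 k {{>-nonZero (<⇒≤ 1<k)}} α) 1≤H) (AE-shift (L * c) (AE-/ L cleanₗ))))
    where
    index : ∀ x c → (K * H * x + 0 + L * c) / L ≡ Z x + c
    index x c = begin
      (K * H * x + 0 + L * c) / L          ≡⟨ cong (λ z → (z + L * c) / L) (trans (+-identityʳ _) (*-assoc K H x)) ⟩
      (K * (H * x) + L * c) / L            ≡⟨ +-distrib-/-∣ʳ (K * (H * x)) (m∣m*n c) ⟩
      K * (H * x) / L + L * c / L          ≡⟨ cong (Z x +_) (trans (cong (_/ L) (*-comm L c)) (m*n/n≡m c L)) ⟩
      Z x + c                              ∎
      where open ≡-Reasoning

  cover : ∀ x t r → t < H → r < K → ∃₂ λ (j : Fin 9) (ρ : Fin L) →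
    K * (H * x + t + 2) + r ≡ L * (Z x + t + toℕ j) + toℕ ρ
  cover x t r t<H r<K = fromℕ< j<9 , fromℕ< ρ<L , (begin
    y                                                            ≡⟨ m≡B*[m/B]+m%B L y ⟩
    L * (y / L) + y % L                                          ≡⟨ cong (λ z → L * z + y % L) (m+[n∸m]≡n Z+t≤) ⟨
    L * (Z x + t + (y / L ∸ (Z x + t))) + y % L                  ≡⟨ cong₂ (λ j ρ → L * (Z x + t + j) + ρ) (Fin.toℕ-fromℕ< j<9) (Fin.toℕ-fromℕ< ρ<L) ⟨
    L * (Z x + t + toℕ (fromℕ< j<9)) + toℕ (fromℕ< ρ<L)          ∎)
    where
    open ≡-Reasoning
    y = K * (H * x + t + 2) + r
    bounds = distance-bounds dist Hδ≤K (<⇒≤ t<H)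
    ρ<L : y % L < L
    ρ<L = m%n<n y L

    LZ≤ : L * Z x ≤ K * (H * x)
    LZ≤ = ≤-trans (≤-reflexive (*-comm L (Z x))) (m/n*n≤m (K * (H * x)) L)

    y≡ : y ≡ K * (H * x) + K * t + 2 * K + r
    y≡ = lemma K (H * x) t r
      where
      lemma : ∀ K X t r → K * (X + t + 2) + r ≡ K * X + K * t + 2 * K + r
      lemma = solve-∀

    lower : (Z x + t) * L ≤ y
    lower = ≤-trans (≤-reflexive (trans (*-comm (Z x + t) L) (*-distribˡ-+ L (Z x) t)))
      (≤-trans (+-mono-≤ LZ≤ (proj₂ bounds))
      (≤-trans (≤-reflexive (sym (+-assoc (K * (H * x)) (K * t) K)))
      (≤-trans (+-monoʳ-≤ (K * (H * x) + K * t) (m≤m+n K (1 * K)))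
      (≤-trans (m≤m+n _ r) (≤-reflexive (sym y≡))))))

    -- The excess is below one `L` for the rounding in `Z x`, plus `K` for the drift, `2 * K` for
    -- the offset 2 and `K` for `r`; and `4 * K ≤ 8 * L`.
    upper : y < (9 + (Z x + t)) * L
    upper = ≤-<-trans (≤-reflexive y≡)
      (<-≤-trans (+-mono-<-≤ (+-monoˡ-< (2 * K) (+-mono-<-≤ <LZ (proj₁ bounds))) (<⇒≤ r<K))
      (≤-trans (≤-reflexive (lemma (Z x) t K L))
      (≤-trans (+-monoʳ-≤ (L + (Z x + t) * L) (*-monoʳ-≤ 4 (distance⇒K≤2L dist 2δ≤K)))
      (≤-reflexive (lemma′ (Z x) t L)))))
      where
      <LZ : K * (H * x) < L + Z x * L
      <LZ = ≤-<-trans (≤-reflexive (m≡m%n+[m/n]*n (K * (H * x)) L))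
        (+-monoˡ-< (Z x * L) (m%n<n (K * (H * x)) L))
      lemma : ∀ Z t K L → L + Z * L + (L * t + K) + 2 * K + K ≡ L + (Z + t) * L + 4 * K
      lemma = solve-∀
      lemma′ : ∀ Z t L → L + (Z + t) * L + 4 * (2 * L) ≡ (9 + (Z + t)) * L
      lemma′ = solve-∀

    Z+t≤ : Z x + t ≤ y / L
    Z+t≤ = ≤-trans (≤-reflexive (sym (m*n/n≡m (Z x + t) L))) (/-monoˡ-≤ L lower)

    j<9 : y / L ∸ (Z x + t) < 9
    j<9 = m<n+o⇒m∸n<o (y / L) (Z x + t) (<-≤-trans (m<n*o⇒m/o<n upper) (≤-reflexive (+-comm 9 (Z x + t))))

  module _ (x u h : ℕ) (1≤h : 1 ≤ h) (u+h<H : u + h < H) (same : code x (u + h) ≡ code x u)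
    (clean : CleanBlock x) where

    n₀ n : ℕ
    n₀ = H * x + u + 2
    n  = H * x + (u + h) + 2

    u<H : u < H
    u<H = ≤-<-trans (m≤m+n u h) u+h<H

    -- Go back by `h` windows of length `K` with equal states of the first automaton, then forward
    -- by `h` windows of length `L` with equal states of the second. By the balance equation this
    -- ends at `K * n + r′`, and `cover` locates that endpoint among the encoded windows.
    matching : ∀ r r′ → r < K → r′ < K → K * h + r′ ≡ r + L * h → f (K * n + r) ≡ f (K * n + r′)
    matching r r′ r<K r′<K balance =
      let j , ρ , y≡ = cover x (u + h) r′ u+h<H r′<K
          rᶠ         = fromℕ< r<K
          r≡         = Fin.toℕ-fromℕ< r<K
      in begin
      f (K * n + r)                                ≡⟨ cong (λ z → f (K * n + z)) r≡ ⟨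
      f (K * n + toℕ rᶠ)                           ≡⟨ proj₁ clean (u + h) u+h<H rᶠ ⟩
      A.rep (stateₖ rᶠ) n                          ≡⟨ proj₁ (code-≡ x same) (stateₖ rᶠ) ⟩
      A.rep (stateₖ rᶠ) n₀                         ≡⟨ proj₁ clean u u<H rᶠ ⟨
      f (K * n₀ + toℕ rᶠ)                          ≡⟨ cong (λ z → f (K * n₀ + z)) r≡ ⟩
      f (K * n₀ + r)                               ≡⟨ cong f (back (toℕ j) (toℕ ρ) y≡) ⟩
      f (L * (Z x + (u + toℕ j)) + toℕ ρ)          ≡⟨ proj₂ clean (u + toℕ j) (+-mono-≤ u<H (<⇒≤ (Fin.toℕ<n j))) ρ ⟩
      B.rep (stateₗ ρ) (Z x + (u + toℕ j))         ≡⟨ cong (B.rep (stateₗ ρ)) (+-assoc (Z x) u (toℕ j)) ⟨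
      B.rep (stateₗ ρ) (Z x + u + toℕ j)           ≡⟨ proj₂ (code-≡ x same) j (stateₗ ρ) ⟨
      B.rep (stateₗ ρ) (Z x + (u + h) + toℕ j)     ≡⟨ cong (B.rep (stateₗ ρ)) (+-assoc (Z x) (u + h) (toℕ j)) ⟩
      B.rep (stateₗ ρ) (Z x + (u + h + toℕ j))     ≡⟨ proj₂ clean (u + h + toℕ j) (+-mono-≤ u+h<H (<⇒≤ (Fin.toℕ<n j))) ρ ⟨
      f (L * (Z x + (u + h + toℕ j)) + toℕ ρ)      ≡⟨ cong (λ z → f (L * z + toℕ ρ)) (+-assoc (Z x) (u + h) (toℕ j)) ⟨
      f (L * (Z x + (u + h) + toℕ j) + toℕ ρ)      ≡⟨ cong f y≡ ⟨
      f (K * n + r′)                               ∎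
      where
      open ≡-Reasoning
      lemma₁ : ∀ K X u h r L → K * (X + u + 2) + (r + L * h) ≡ K * (X + u + 2) + r + L * h
      lemma₁ = solve-∀
      lemma₂ : ∀ K X u h r → K * (X + u + 2) + (K * h + r) ≡ K * (X + (u + h) + 2) + r
      lemma₂ = solve-∀
      lemma₃ : ∀ L Z u h j ρ → L * (Z + (u + h) + j) + ρ ≡ L * (Z + (u + j)) + ρ + L * h
      lemma₃ = solve-∀
      back : ∀ j ρ → K * n + r′ ≡ L * (Z x + (u + h) + j) + ρ → K * n₀ + r ≡ L * (Z x + (u + j)) + ρ
      back j ρ y≡ = +-cancelʳ-≡ (L * h) _ _ (begin
        K * n₀ + r + L * h                   ≡⟨ lemma₁ K (H * x) u h r L ⟨
        K * n₀ + (r + L * h)                 ≡⟨ cong (K * n₀ +_) balance ⟨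
        K * n₀ + (K * h + r′)                ≡⟨ lemma₂ K (H * x) u h r′ ⟩
        K * n + r′                           ≡⟨ y≡ ⟩
        L * (Z x + (u + h) + j) + ρ          ≡⟨ lemma₃ L (Z x) u h j ρ ⟩
        L * (Z x + (u + j)) + ρ + L * h      ∎)

    -- `matching` displaces by h(L - K), which is `h * δ` up to sign; for `K ≡ L + δ` it is read
    -- backwards.
    periodic-h*δ : PeriodicOnWindow f K (h * δ) n
    periodic-h*δ r r+hδ<K = by-sign dist
      where
      r<K : r < K
      r<K = ≤-<-trans (m≤m+n r (h * δ)) r+hδ<K
      lemma₁ : ∀ L δ h r → (L + δ) * h + r ≡ r + h * δ + L * h
      lemma₁ = solve-∀
      lemma₂ : ∀ K δ h r → K * h + (r + h * δ) ≡ r + (K + δ) * h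
      lemma₂ = solve-∀
      by-sign : Distance K L δ → f (K * n + r) ≡ f (K * n + (r + h * δ))
      by-sign (inj₁ K≡) = sym (matching (r + h * δ) r r+hδ<K r<K
        (trans (cong (λ z → z * h + r) K≡) (lemma₁ L δ h r)))
      by-sign (inj₂ L≡) = matching r (r + h * δ) r<K r+hδ<K
        (trans (lemma₂ K δ h r) (cong (λ z → r + z * h) (sym L≡)))

    -- The return time `h` varies with the window; `H !` is a common multiple of all of them.
    periodic-H!*δ : PeriodicOnWindow f K (H ! * δ) n
    periodic-H!*δ with divides c H!≡ ← n∣N! 1≤h (≤-trans (m≤n+m h u) (<⇒≤ u+h<H)) =
      subst (λ p → PeriodicOnWindow f K p n)
        (trans (sym (*-assoc c h δ)) (cong (_* δ) (sym H!≡)))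
        (periodic-multiple f K (h * δ) n periodic-h*δ c)

  most-periodic : ∀ M .{{_ : NonZero H}} → 2 * (2 * (2 * M)) * (m ^ A.d * (m ^ B.d) ^ 9) ≤ H →
    Most M (PeriodicOnWindow f K (H ! * δ))
  -- The shift by 2 undoes the offset in the indexing of the encoded windows.
  most-periodic M le = Most-unshift 2 M (Most-map (2 * M) periodic (Most-zip (2 * M)
    (Most-repeats (2 * (2 * M)) _ H (λ x t → toℕ (code x t)) (λ x t → Fin.toℕ<n (code x t)) le)
    (AE-/ H (cleanBlock (>-nonZero⁻¹ H)) (2 * (2 * M)))))
    where
    periodic : ∀ y → Repeats (λ t → toℕ (code (y / H) t)) (y % H) × CleanBlock (y / H) →
      PeriodicOnWindow f K (H ! * δ) (y + 2)
    periodic y ((u , same) , clean) =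
      subst (PeriodicOnWindow f K (H ! * δ)) index
        (periodic-H!*δ (y / H) (toℕ u) h (m<n⇒0<n∸m (Fin.toℕ<n u)) (subst (_< H) (sym u+h≡) (m%n<n y H))
          (Fin.toℕ-injective (trans (cong (λ t → toℕ (code (y / H) t)) u+h≡) (sym same))) clean)
      where
      h = y % H ∸ toℕ u
      u+h≡ : toℕ u + h ≡ y % H
      u+h≡ = m+[n∸m]≡n (<⇒≤ (Fin.toℕ<n u))
      index : H * (y / H) + (toℕ u + h) + 2 ≡ y + 2
      index = cong (_+ 2) (trans (cong (H * (y / H) +_) u+h≡) (sym (m≡B*[m/B]+m%B H y)))

module _ {Ω : Set a} {m : ℕ} (enc : Ω → Fin m) (enc-injective : ∀ {x y} → enc x ≡ enc y → x ≡ y)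
  {k l : ℕ} {f : ℕ → Ω} (1<k : 1 < k) (1<l : 1 < l) (indep : MultiplicativelyIndependent k l)
  (autₖ : Automaton k f) (autₗ : Automaton l f) where

  ∃-local-period : ∀ M C → ∃₂ λ α p → 1 ≤ p × C * p ≤ k ^ α × Most M (PeriodicOnWindow f (k ^ α) p)
  ∃-local-period M C =
    -- `H` depends on `M` and the number of codes only, so it is fixed before the powers; `suc`
    -- makes it non-zero.
    let H = suc (2 * (2 * (2 * M)) * (m ^ Automaton.d autₖ * (m ^ Automaton.d autₗ) ^ 9))
        -- The three summands serve `C * p ≤ k ^ α` for `p = H ! * δ`, the drift bound
        -- `H * δ ≤ k ^ α` and `2 * δ ≤ k ^ α`.
        α , β , δ , 1≤δ , dist , close = ∃-close-powers 1<k 1<l indep (C * H ! + H + 2)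
        scaled : ∀ c → c ≤ C * H ! + H + 2 → c * δ ≤ k ^ α
        scaled c c≤ = ≤-trans (*-monoˡ-≤ δ (m≤n⇒m≤1+n c≤)) close
    in α , H ! * δ , *-mono-≤ (1≤n! H) 1≤δ ,
       ≤-trans (≤-reflexive (sym (*-assoc C (H !) δ))) (scaled (C * H !) (≤-trans (m≤m+n (C * H !) H) (m≤m+n _ 2))) ,
       Windows.most-periodic enc enc-injective 1<k 1<l autₖ autₗ α β δ H dist
         (scaled H (≤-trans (m≤n+m H (C * H !)) (m≤m+n _ 2))) (scaled 2 (m≤n+m 2 (C * H ! + H))) M (n≤1+n _)

theoremA : {a : Level} {Ω : Set a} (finite : Finite Ω) (let open Asymptotic finite)
    (k l : ℕ) → 2 ≤ k → 2 ≤ l → MultiplicativelyIndependent k l →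
    (f : ℕ → Ω) → AsymptoticallyAutomatic k f → AsymptoticallyAutomatic l f →
    ∃ λ q → 1 ≤ q × (λ n → f (n + q)) ≃ f
theoremA finite k l 2≤k 2≤l indep f autoₖ autoₗ =
  let autₖ = automaton finite autoₖ
      enc  = Inverse⇒Injection (proj₂ finite)
      q , 1≤q , invariant = shift-invariant 2≤k autₖ
        (∃-local-period (Injection.to enc) (Injection.injective enc) 2≤k 2≤l indep autₖ (automaton finite autoₗ))
  in q , 1≤q , AE⇒AlmostAll (λ n → finite⇒≟ finite (f (n + q)) (f n)) invariant
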